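{- Let $N\ge9$ and let $C$ be an admissible linear code of length $5$ over $\mathbb{Z}_N$ that can be generated by a matrix with $m=2$ rows. Suppose $C$ is non-degenerate and not a direct sum. Then $C$ is thin if and only if $N$ is even and, up to isomorphism, the generating matrix of $C$ can be chosen as $$g=\begin{pmatrix}N/2&N/2&0&0&0\\N/2&0&N/2&1&N-1\end{pmatrix}.$$
   Context: $\mathbb{Z}_N=\mathbb{Z}/N\mathbb{Z}$, with elements identified with the representatives $0,\dots,N-1$. A linear code of length $n$ over $\mathbb{Z}_N$ is a submodule of $\mathbb{Z}_N^n$; its elements are words; a generating matrix is a matrix whose rows generate it. It is extended if all words have coordinate sum $0\bmod N$. Call a linear code over $\mathbb{Z}_N$ admissible if it is extended and the greatest common divisor of $N$ and all entries of all words is $1$. It is degenerate if some coordinate is zero in all words. An extended code is thin if it contains no word with all entries nonzero. Two codes over the same $\mathbb{Z}_N$ and of the same length are isomorphic if they coincide after a permutation of coordinates. Direct sum: for codes $C_1$ over $\mathbb{Z}_{N_1}$ and $C_2$ over $\mathbb{Z}_{N_2}$, of lengths $\ge1$, with $L=\operatorname{lcm}(N_1,N_2)$, $C_1\oplus C_2$ is the code over $\mathbb{Z}_L$ consisting of all concatenations $\frac{L}{N_1}c_1\,|\,\frac{L}{N_2}c_2$, $c_1\in C_1$, $c_2\in C_2$. A code is a direct sum if it is isomorphic to some $C_1\oplus C_2$. -}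

module Defs where

open import Data.Fin.Base using (Fin; toℕ)
open import Data.Fin.Permutation using (Permutation; _⟨$⟩ˡ_)
open import Data.Nat.Base using (ℕ; NonZero; _+_; _*_; _∸_; _/_)
open import Data.Nat.Divisibility using (_∣_)
open import Data.Nat.DivMod using (_mod_)
open import Data.Nat.LCM using (lcm)
open import Data.Product.Base using (Σ-syntax; ∃-syntax; _×_)
open import Data.Sum.Base using (_⊎_)
open import Data.Vec.Base
  using (Vec; []; _∷_; _++_; map; zipWith; foldr; sum; lookup; tabulate; replicate)
open import Function.Bundles using (_⇔_)
open import Level using (0ℓ)
open import Relation.Binary.PropositionalEquality.Core using (_≡_; _≢_)
open import Relation.Nullary.Negation.Core using (¬_)
open import Relation.Unary using (Pred; _∈_; _≐_)

private
  variable
    m n N : ℕ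

-- ℤ/Nℤ, an element being its representative in {0, …, N-1}.
ℤ/ : ℕ → Set
ℤ/ = Fin

module _ {N : ℕ} .{{_ : NonZero N}} where

  0# : ℤ/ N
  0# = 0 mod N

  infixl 6 _+ᴺ_
  _+ᴺ_ : ℤ/ N → ℤ/ N → ℤ/ N
  x +ᴺ y = (toℕ x + toℕ y) mod N

  infixl 7 _*ᴺ_
  _*ᴺ_ : ℤ/ N → ℤ/ N → ℤ/ N
  x *ᴺ y = (toℕ x * toℕ y) mod N

Word : ℕ → ℕ → Set
Word N n = Vec (ℤ/ N) n

module _ {N n : ℕ} .{{_ : NonZero N}} where

  0ʷ : Word N n
  0ʷ = replicate n 0#

  infixl 6 _+ʷ_
  _+ʷ_ : Word N n → Word N n → Word N n
  _+ʷ_ = zipWith _+ᴺ_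

  infixr 7 _*ʷ_
  _*ʷ_ : ℤ/ N → Word N n → Word N n
  a *ʷ w = map (a *ᴺ_) w

-- A set of words; linearity is the separate predicate IsLinear.
Code : ℕ → ℕ → Set₁
Code N n = Pred (Word N n) 0ℓ

record IsLinear .{{_ : NonZero N}} (C : Code N n) : Set where
  field
    0-closed : 0ʷ ∈ C
    +-closed : ∀ {v w} → v ∈ C → w ∈ C → (v +ʷ w) ∈ C
    *-closed : ∀ a {w} → w ∈ C → (a *ʷ w) ∈ C

-- A matrix is the vector of its rows.
Matrix : ℕ → ℕ → ℕ → Set
Matrix N m n = Vec (Word N n) m

combination : .{{_ : NonZero N}} → Vec (ℤ/ N) m → Matrix N m n → Word N n
combination a G = foldr _ _+ʷ_ 0ʷ (zipWith _*ʷ_ a G)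

rowSpan : .{{_ : NonZero N}} → Matrix N m n → Code N n
rowSpan {N} {m} G w = ∃[ a ] w ≡ combination {N} {m} a G

IsGeneratedBy : .{{_ : NonZero N}} → Code N n → Matrix N m n → Set
IsGeneratedBy C G = C ≐ rowSpan G

Extended : Code N n → Set
Extended {N} C = ∀ {w} → w ∈ C → N ∣ sum (map toℕ w)

record IsGCD (S : Pred ℕ 0ℓ) (d : ℕ) : Set where
  field
    commonDivisor : ∀ {k} → k ∈ S → d ∣ k
    greatest      : ∀ {e} → (∀ {k} → k ∈ S → e ∣ k) → e ∣ d

Entry : Code N n → Pred ℕ 0ℓ
Entry C k = ∃[ w ] w ∈ C × ∃[ i ] k ≡ toℕ (lookup w i)

Admissible : Code N n → Set
Admissible {N} C = Extended C × IsGCD (λ k → k ≡ N ⊎ k ∈ Entry C) 1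

Degenerate : .{{_ : NonZero N}} → Code N n → Set
Degenerate C = ∃[ i ] (∀ {w} → w ∈ C → lookup w i ≡ 0#)

Thin : .{{_ : NonZero N}} → Code N n → Set
Thin C = ¬ (∃[ w ] w ∈ C × (∀ i → lookup w i ≢ 0#))

permute : Permutation m n → Word N m → Word N n
permute π w = tabulate (λ i → lookup w (π ⟨$⟩ˡ i))

-- The two lengths are necessarily equal, being related by a permutation;
-- they need not be judgementally equal, which matters for lengths n₁ + n₂.
infix 4 _≅_
_≅_ : Code N m → Code N n → Set
_≅_ {m = m} {n = n} C D =
  Σ[ π ∈ Permutation m n ] (∀ w → w ∈ C ⇔ permute π w ∈ D)

-- L/N · x as an element of ℤ/L, for x in ℤ/N (used when N divides L).
rescale : (L : ℕ) .{{_ : NonZero L}} .{{_ : NonZero N}} → ℤ/ N → ℤ/ L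
rescale {N} L x = (L / N * toℕ x) mod L

-- The modulus L comes with a proof that it is lcm N₁ N₂, rather than being
-- that expression, so that codes over a given ℤ/N can be compared with sums.
directSum : ∀ {N₁ N₂ n₁ n₂} (L : ℕ)
            .{{_ : NonZero L}} .{{_ : NonZero N₁}} .{{_ : NonZero N₂}} →
            L ≡ lcm N₁ N₂ → Code N₁ n₁ → Code N₂ n₂ → Code L (n₁ + n₂)
directSum L _ C₁ C₂ w =
  ∃[ c₁ ] ∃[ c₂ ] c₁ ∈ C₁ × c₂ ∈ C₂ ×
    w ≡ map (rescale L) c₁ ++ map (rescale L) c₂

record IsDirectSum .{{_ : NonZero N}} (C : Code N n) : Set₁ where
  field
    {N₁ N₂ n₁ n₂} : ℕ
    .{{N₁≢0}}     : NonZero N₁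
    .{{N₂≢0}}     : NonZero N₂
    .{{n₁≢0}}     : NonZero n₁
    .{{n₂≢0}}     : NonZero n₂
    N≡lcm         : N ≡ lcm N₁ N₂
    C₁            : Code N₁ n₁
    C₂            : Code N₂ n₂
    C₁-linear     : IsLinear C₁
    C₂-linear     : IsLinear C₂
    C≅C₁⊕C₂       : C ≅ directSum N N≡lcm C₁ C₂

-- The entries N/2 are meaningful only for even N: _/_ rounds down.
thinMatrix : (N : ℕ) .{{_ : NonZero N}} → Matrix N 2 5
thinMatrix N =
  (h ∷ h ∷ o ∷ o ∷ o ∷ []) ∷
  (h ∷ o ∷ h ∷ (1 mod N) ∷ ((N ∸ 1) mod N) ∷ []) ∷ []
  where
  h o : ℤ/ N
  h = (N / 2) mod N
  o = 0#

{-# OPTIONS --safe #-}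

-- A code spanned by two rows is thin iff ℤ² is covered by the five subgroups Hᵢ on which
-- the i-th coordinate vanishes. Pass to an irredundant subcovering by n of them: an element
-- of n - 1 of these lies in all n, and for every j some yⱼ lies in Hⱼ only. For x ∈ ℤ² the
-- coverings of the progressions yⱼ + k x by residue classes of k bound the exponent of
-- x modulo ⋂ Hᵢ: it divides 1 for n ≤ 2, 2 for n = 3, and 6 or 8 for n = 4, 5 (a finite
-- search). The coordinates have zero sum and no common factor with N, so N ≤ 8 if n ≥ 4, and
-- n ≤ 2 makes a coordinate vanish. If n = 3, three coordinates are N/2 times the three
-- nonzero linear forms modulo 2 and the other two are χ and -χ. If χ is even, the code is a
-- direct sum over ℤ/2 and ℤ/(N/2) with N/2 odd; otherwise χ is congruent modulo 2 to one of
-- the three forms, which gives the matrix.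

module Submission where

open import Defs
open import Algebra.Properties.CommutativeMonoid.Sum using (sum-permute)
open import Data.Bool.Base using (Bool; true; false; T; _∧_; _∨_; not; if_then_else_)
open import Data.Bool.ListAction using (any)
open import Data.Bool.Properties using (T-∧; T-∨)
open import Data.Empty using (⊥; ⊥-elim)
open import Data.Fin.Base using (Fin; zero; suc; toℕ; fromℕ<; inject≤)
open import Data.Fin.Patterns using (0F; 1F; 2F; 3F; 4F)
open import Data.Fin.Permutation as Perm
  using (Permutation′; _⟨$⟩ˡ_; _⟨$⟩ʳ_; inverseˡ; _∘ₚ_; transpose; flip)
open import Data.Fin.Properties
  using (_≟_; any?; all?; toℕ-fromℕ<; toℕ-injective; toℕ<n; toℕ-inject≤; ¬∀⟶∃¬; inject≤-injective)
open import Data.Integer.Base as ℤ using (ℤ; +_; 0ℤ; 1ℤ; -1ℤ)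
open import Data.Integer.DivMod using (_%ℕ_; _/ℕ_; n%ℕd<d; a≡a%ℕn+[a/ℕn]*n)
import Data.Integer.Divisibility.Signed as ℤ
import Data.Integer.Properties as ℤ
open import Data.Integer.Tactic.RingSolver using () renaming (solve-∀ to ℤ-solve-∀)
open import Data.List.Base using (List; []; _∷_; allFin)
import Data.List.Membership.Propositional as List
open import Data.List.Relation.Unary.Any using (here; there)
open import Data.List.Relation.Unary.Any.Properties using (any⁻)
open import Data.Maybe.Base using (Maybe; just; nothing)
open import Data.Nat.Base
open import Data.Nat.Divisibility
open import Data.Nat.DivMod using (_mod_; m*n/n≡m; m≡m%n+[m/n]*n; m%n<n)
open import Data.Nat.GCD
  using (gcd; gcd[m,n]∣m; gcd[m,n]∣n; gcd-greatest; gcd-GCD; c*gcd[m,n]≡gcd[cm,cn]; module Bézout)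
open import Data.Nat.LCM using (lcm; gcd*lcm)
open import Data.Nat.Properties as ℕ
  using (≡ᵇ⇒≡; +-comm; *-comm; *-identityˡ; *-distribʳ-∣-∣; ∣m+n-m+o∣≡∣n-o∣; m≤n⇒∣m-n∣≡n∸m;
         m≤n⇒∣n-m∣≡n∸m; ≤-total; m+[n∸m]≡n; ≤-trans; n≤1+n; ≤∧≢⇒<; _<?_)
open import Data.Nat.Tactic.RingSolver using (solve-∀)
open import Data.Product.Base using (_×_; _,_; proj₁; proj₂; ∃-syntax; ∃₂)
open import Data.Sum.Base using (_⊎_; inj₁; inj₂; [_,_]′)
open import Data.Vec.Base
  using (Vec; []; _∷_; lookup; replicate; tabulate; map; _++_; sum; _[_]≔_)
import Data.Vec.Functional as Table
open import Data.Vec.Properties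
  using (lookup∘update; lookup∘update′; lookup-replicate; lookup-zipWith; lookup-map;
         lookup∘tabulate; tabulate∘lookup; tabulate-cong)
open import Function.Base using (_∘_)
open import Function.Bundles using (_⇔_; mk⇔; Equivalence)
open import Relation.Binary.PropositionalEquality
open import Relation.Nullary.Decidable
  using (Dec; yes; no; ⌊_⌋; map′; ¬?; _×-dec_; _⊎-dec_; _→-dec_; decidable-stable; from-yes)
open import Relation.Nullary.Negation using (¬_; contradiction)
open import Relation.Unary using (_∈_)

private
  variable
    n N : ℕ
    x y z u v : ℤ

-- Coverings of ℕ by residue classes

infix 7 _∣ᵇ_
_∣ᵇ_ : ℕ → ℕ → Bool
zero  ∣ᵇ n = n ≡ᵇ 0
suc m ∣ᵇ n = n % suc m ≡ᵇ 0

∣ᵇ⇒∣ : ∀ m n → T (m ∣ᵇ n) → m ∣ n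
∣ᵇ⇒∣ zero    n t rewrite ≡ᵇ⇒≡ n 0 t = ∣-refl
∣ᵇ⇒∣ (suc m) n t = m%n≡0⇒n∣m n (suc m) (≡ᵇ⇒≡ _ 0 t)

∨-elim : ∀ a {b} → T (a ∨ b) → T a ⊎ T b
∨-elim a = Equivalence.to (T-∨ {a})

∧-elim : ∀ a {b} → T (a ∧ b) → T a × T b
∧-elim a = Equivalence.to (T-∧ {a})

if-elim : ∀ a {b c} → T (if a then b else c) → T b ⊎ T c
if-elim false = inj₂
if-elim true  = inj₁

every some : ∀ {n} → (Fin n → Bool) → Bool
every {zero}  p = true
every {suc n} p = p zero ∧ every (p ∘ suc)
some {zero}  p = false
some {suc n} p = p zero ∨ some (p ∘ suc)

every-elim : ∀ {n} (p : Fin n → Bool) → T (every p) → ∀ i → T (p i)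
every-elim p t zero    = proj₁ (∧-elim (p zero) t)
every-elim p t (suc i) = every-elim (p ∘ suc) (proj₂ (∧-elim (p zero) t)) i

some-elim : ∀ {n} (p : Fin n → Bool) → T (some p) → ∃[ i ] T (p i)
some-elim {suc n} p t with ∨-elim (p zero) t
... | inj₁ t₁ = zero , t₁
... | inj₂ t₁ with i , t₂ ← some-elim (p ∘ suc) t₁ = suc i , t₂

-- For numbers xᵢ and yⱼᵢ (i, j < n) with: N ∣ yⱼᵢ iff i = j; for all j and k some i has
-- N ∣ yⱼᵢ + k xᵢ; and e x vanishes modulo N once all but one of its entries do. The search
-- goes through j and k, branching over i. It records periods pᵢ with N ∣ pᵢ xᵢ and, for
-- the current j, anchors cᵢ with N ∣ yⱼᵢ + cᵢ xᵢ; a branch closes when some exponent e is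
-- seen to annihilate x, or when pᵢ ∣ cᵢ for some i ≠ j.
module Search (n : ℕ) (exponents window : List ℕ) where

  Periods Anchors : Set
  Periods = Vec ℕ n
  Anchors = Vec (Maybe ℕ) n

  anchor : ℕ → Maybe ℕ → ℕ
  anchor k nothing  = k
  anchor k (just c) = c

  hit : ℕ → ℕ → Maybe ℕ → Bool
  hit k p nothing  = false
  hit k p (just c) = p ∣ᵇ ∣ k - c ∣

  killsBut : Periods → ℕ → Fin n → Fin n → Bool
  killsBut m e j i = (lookup m i ∣ᵇ e) ∨ ⌊ i ≟ j ⌋

  killed : Periods → Bool
  killed m = any (λ e → some λ j → every (killsBut m e j)) exponents

  mutual
    systems : List (Fin n) → Periods → Bool
    systems []       m = killed m
    systems (j ∷ js) m = points j js (replicate n nothing [ j ]≔ just 0) m window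

    points : Fin n → List (Fin n) → Anchors → Periods → List ℕ → Bool
    points j js a m []       = systems js m
    points j js a m (k ∷ ks) =
      if some (λ i → hit k (lookup m i) (lookup a i))
      then points j js a m ks
      else every (λ i → attach j js a m k ks i (anchor k (lookup a i)))

    attach : Fin n → List (Fin n) → Anchors → Periods → ℕ → List ℕ → Fin n → ℕ → Bool
    attach j js a m k ks i c = refine j js a m ks i c (gcd (lookup m i) ∣ k - c ∣)

    refine : Fin n → List (Fin n) → Anchors → Periods → List ℕ → Fin n → ℕ → ℕ → Bool
    refine j js a m ks i c p =
      (p ∣ᵇ c ∧ not ⌊ i ≟ j ⌋) ∨ proceed j js (a [ i ]≔ just c) (m [ i ]≔ p) ks

    proceed : Fin n → List (Fin n) → Anchors → Periods → List ℕ → Bool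
    proceed j js a m ks = killed m ∨ points j js a m ks

  search : Bool
  search = every λ i → systems (allFin n) (replicate n 0 [ i ]≔ 1)

  -- A record rather than an equation, so that comparing types never runs the search.
  record Certified : Set where
    constructor certified
    field
      accepted : search ≡ true

  certified⇒T : Certified → T search
  certified⇒T (certified ok) = subst T (sym ok) _

  module Soundness
    (N : ℕ) (x : Fin n → ℕ) (y : Fin n → Fin n → ℕ)
    (covers   : ∀ j k → ∃[ i ] N ∣ y j i + k * x i)
    (vanishes : ∀ j → N ∣ y j j)
    (unique   : ∀ j i → N ∣ y j i → i ≡ j)
    (closed   : ∀ e j → (∀ i → i ≢ j → N ∣ e * x i) → N ∣ e * x j)
    where

    Killed : Set
    Killed = ∃[ e ] e List.∈ exponents × (∀ i → N ∣ e * x i)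

    Annihilates : Periods → Set
    Annihilates m = ∀ i → N ∣ lookup m i * x i

    Anchored : Fin n → Anchors → Set
    Anchored j a = ∀ i {c} → lookup a i ≡ just c → N ∣ y j i + c * x i

    killed-sound : ∀ m → Annihilates m → T (killed m) → Killed
    killed-sound m ann t
      with e , e∈ , t₁ ← List.find (any⁻ _ exponents t)
      with j , t₂ ← some-elim (λ j → every (killsBut m e j)) t₁ = e , e∈ , kills
      where
      killsOther : ∀ i → i ≢ j → N ∣ e * x i
      killsOther i i≢j with ∨-elim (lookup m i ∣ᵇ e) (every-elim (killsBut m e j) t₂ i)
      ... | inj₁ p∣e = ∣-trans (ann i) (*-monoˡ-∣ (x i) (∣ᵇ⇒∣ (lookup m i) e p∣e))
      ... | inj₂ i≡j with yes i≡j ← i ≟ j = contradiction i≡j i≢j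

      kills : ∀ i → N ∣ e * x i
      kills i with i ≟ j
      ... | yes refl = closed e i killsOther
      ... | no  i≢j  = killsOther i i≢j

    ∣-difference : ∀ b c u v → N ∣ u + b * v → N ∣ u + c * v → N ∣ ∣ b - c ∣ * v
    ∣-difference b c u v p q = subst (N ∣_)
      (trans (∣m+n-m+o∣≡∣n-o∣ u (b * v) (c * v)) (sym (*-distribʳ-∣-∣ v b c)))
      (∣∣-∣ (u + b * v) (u + c * v) p q)
      where
      ∣∣-∣ : ∀ m n → N ∣ m → N ∣ n → N ∣ ∣ m - n ∣
      ∣∣-∣ m n p q with ≤-total m n
      ... | inj₁ m≤n rewrite m≤n⇒∣m-n∣≡n∸m m≤n =
        ∣m+n∣m⇒∣n (subst (N ∣_) (sym (m+[n∸m]≡n m≤n)) q) p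
      ... | inj₂ n≤m rewrite m≤n⇒∣n-m∣≡n∸m n≤m =
        ∣m+n∣m⇒∣n (subst (N ∣_) (sym (m+[n∸m]≡n n≤m)) p) q

    ∣-gcd : ∀ b c v → N ∣ b * v → N ∣ c * v → N ∣ gcd b c * v
    ∣-gcd b c v p q = subst (N ∣_)
      (trans (sym (c*gcd[m,n]≡gcd[cm,cn] v b c)) (*-comm v _))
      (gcd-greatest (subst (N ∣_) (*-comm b v) p) (subst (N ∣_) (*-comm c v) q))

    annihilates-update : ∀ m i p → Annihilates m → N ∣ p * x i → Annihilates (m [ i ]≔ p)
    annihilates-update m i p ann p∣ i′ with i′ ≟ i
    ... | yes refl rewrite lookup∘update i m p = p∣
    ... | no i′≢i  rewrite lookup∘update′ i′≢i m p = ann i′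

    anchored-update : ∀ j a i c → Anchored j a → N ∣ y j i + c * x i →
                      Anchored j (a [ i ]≔ just c)
    anchored-update j a i c anc c∣ i′ eq with i′ ≟ i
    ... | yes refl with refl ← trans (sym (lookup∘update i a (just c))) eq = c∣
    ... | no i′≢i = anc i′ (trans (sym (lookup∘update′ i′≢i a (just c))) eq)

    anchor-sound : ∀ j a i {k} → Anchored j a → N ∣ y j i + k * x i →
                   N ∣ y j i + anchor k (lookup a i) * x i
    anchor-sound j a i anc k∣ with lookup a i in eq
    ... | nothing = k∣
    ... | just c  = anc i eq

    unanchored : ∀ j → Anchored j (replicate n nothing)
    unanchored j i eq with () ← trans (sym (lookup-replicate i nothing)) eq

    mutual
      systems-sound : ∀ js m → Annihilates m → T (systems js m) → Killed
      systems-sound []       m ann = killed-sound m ann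
      systems-sound (j ∷ js) m ann = points-sound j js _ m window ann
        (anchored-update j (replicate n nothing) j 0 (unanchored j) (∣m∣n⇒∣m+n (vanishes j) (N ∣0)))

      points-sound : ∀ j js a m ks → Annihilates m → Anchored j a →
                     T (points j js a m ks) → Killed
      points-sound j js a m []       ann anc t = systems-sound js m ann t
      points-sound j js a m (k ∷ ks) ann anc t
        with if-elim (some (λ i → hit k (lookup m i) (lookup a i))) t
      ... | inj₁ t₁ = points-sound j js a m ks ann anc t₁
      ... | inj₂ t₁ with i , k∣ ← covers j k =
        attach-sound j js a m k ks i _ ann anc k∣ (anchor-sound j a i anc k∣)
          (every-elim (λ i → attach j js a m k ks i (anchor k (lookup a i))) t₁ i)

      attach-sound : ∀ j js a m k ks i c → Annihilates m → Anchored j a →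
                     N ∣ y j i + k * x i → N ∣ y j i + c * x i →
                     T (attach j js a m k ks i c) → Killed
      attach-sound j js a m k ks i c ann anc k∣ c∣ =
        refine-sound j js a m ks i c (gcd (lookup m i) ∣ k - c ∣) ann anc c∣
        (∣-gcd (lookup m i) ∣ k - c ∣ (x i) (ann i) (∣-difference k c (y j i) (x i) k∣ c∣))

      refine-sound : ∀ j js a m ks i c p → Annihilates m → Anchored j a →
                     N ∣ y j i + c * x i → N ∣ p * x i →
                     T (refine j js a m ks i c p) → Killed
      refine-sound j js a m ks i c p ann anc c∣ p∣ t
        with ∨-elim (p ∣ᵇ c ∧ not ⌊ i ≟ j ⌋) t
      ... | inj₂ t₁ = proceed-sound j js _ _ ks
        (annihilates-update m i p ann p∣) (anchored-update j a i c anc c∣) t₁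
      ... | inj₁ t₁ with p∣c , i≢j ← ∧-elim (p ∣ᵇ c) t₁ | i ≟ j
      ...   | no i≢j = contradiction (unique j i (∣m+n∣n⇒∣m c∣)) i≢j
        where
        ∣m+n∣n⇒∣m : N ∣ y j i + c * x i → N ∣ y j i
        ∣m+n∣n⇒∣m h = ∣m+n∣m⇒∣n (subst (N ∣_) (+-comm (y j i) _) h)
          (∣-trans p∣ (*-monoˡ-∣ (x i) (∣ᵇ⇒∣ p c p∣c)))

      proceed-sound : ∀ j js a m ks → Annihilates m → Anchored j a →
                      T (proceed j js a m ks) → Killed
      proceed-sound j js a m ks ann anc t with ∨-elim (killed m) t
      ... | inj₁ t₁ = killed-sound m ann t₁
      ... | inj₂ t₁ = points-sound j js a m ks ann anc t₁

    search-sound : T search → ∀ i → N ∣ x i → Killed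
    search-sound t i x∣ = systems-sound (allFin n) _
      (annihilates-update (replicate n 0) i 1 zeros (subst (N ∣_) (sym (*-identityˡ (x i))) x∣))
      (every-elim (λ i → systems (allFin n) (replicate n 0 [ i ]≔ 1)) t i)
      where
      zeros : Annihilates (replicate n 0)
      zeros i rewrite lookup-replicate i 0 = N ∣0

window : List ℕ
window = 1 ∷ 2 ∷ 3 ∷ 4 ∷ 5 ∷ 6 ∷ 7 ∷ 8 ∷ 9 ∷ 10 ∷ []

certificate₁ : Search.Certified 1 (1 ∷ []) window
certificate₁ = Search.certified refl

certificate₂ : Search.Certified 2 (1 ∷ []) window
certificate₂ = Search.certified refl

certificate₃ : Search.Certified 3 (2 ∷ []) window
certificate₃ = Search.certified refl

certificate₄ : Search.Certified 4 (6 ∷ 8 ∷ []) window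
certificate₄ = Search.certified refl

certificate₅ : Search.Certified 5 (6 ∷ 8 ∷ []) window
certificate₅ = Search.certified refl

-- Coverings of ℤ² by kernels of linear forms

∃₂? : ∀ N .{{_ : NonZero N}} {P : ℕ → ℕ → Set} → (∀ s t → Dec (P s t)) →
      (∀ s t → P s t → P (s % N) (t % N)) → Dec (∃₂ P)
∃₂? N {P} P? reduce = map′ (λ (s , t , q) → toℕ s , toℕ t , q) shrink
  (any? λ (s : Fin N) → any? λ (t : Fin N) → P? (toℕ s) (toℕ t))
  where
  shrink : ∃₂ P → ∃[ s ] ∃[ t ] P (toℕ {N} s) (toℕ {N} t)
  shrink (s , t , q) = fromℕ< (m%n<n s N) , fromℕ< (m%n<n t N) ,
    subst₂ P (sym (toℕ-fromℕ< (m%n<n s N))) (sym (toℕ-fromℕ< (m%n<n t N))) (reduce s t q)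

module Forms (N : ℕ) .{{_ : NonZero N}} where

  value : ∀ {n} (a b : Fin n → ℕ) → ℕ → ℕ → Fin n → ℕ
  value a b s t i = s * a i + t * b i

  module _ {n} (a b : Fin n → ℕ) where

    Covering : Set
    Covering = ∀ s t → ∃[ i ] N ∣ value a b s t i

    Essential : Fin n → Set
    Essential i = ∃₂ λ s t → N ∣ value a b s t i × (∀ j → N ∣ value a b s t j → j ≡ i)

    value-shift : ∀ s t s₁ t₁ k i →
                  value a b (s + k * s₁) (t + k * t₁) i ≡ value a b s t i + k * value a b s₁ t₁ i
    value-shift s t s₁ t₁ k i = lemma s t s₁ t₁ k (a i) (b i)
      where
      lemma : ∀ s t s₁ t₁ k u v → (s + k * s₁) * u + (t + k * t₁) * v ≡ s * u + t * v + k * (s₁ * u + t₁ * v)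
      lemma = solve-∀

    -- If x lies in all the subgroups but the j-th, add an element y lying in the j-th
    -- one only: x + y can lie in no other subgroup than the j-th.
    irredundant-closed : Covering → (∀ i → Essential i) → ∀ e s t j →
                         (∀ i → i ≢ j → N ∣ e * value a b s t i) → N ∣ e * value a b s t j
    irredundant-closed cov ess e s t j others
      with s₁ , t₁ , y∣ , only ← ess j
      with i , z∣ ← cov (s₁ + e * s) (t₁ + e * t)
      with i ≟ j | subst (N ∣_) (value-shift s₁ t₁ s t e i) z∣
    ... | yes refl | z∣′ = ∣m+n∣m⇒∣n z∣′ y∣
    ... | no  i≢j  | z∣′ = contradiction
      (only i (∣m+n∣m⇒∣n (subst (N ∣_) (+-comm (value a b s₁ t₁ i) _) z∣′) (others i i≢j))) i≢j

    covering-exponent : ∀ exponents window → Search.Certified n exponents window →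
                        Covering → (∀ i → Essential i) → ∀ s t →
                        ∃[ e ] e List.∈ exponents × (∀ i → N ∣ e * value a b s t i)
    covering-exponent exponents window ok cov ess s t = let i , x∣ = cov s t in
      Search.Soundness.search-sound n exponents window N
        (value a b s t)
        (λ j → value a b (proj₁ (ess j)) (proj₁ (proj₂ (ess j))))
        (λ j k → let s₁ , t₁ , _ = ess j
                     i , z∣ = cov (s₁ + k * s) (t₁ + k * t)
                 in i , subst (N ∣_) (value-shift s₁ t₁ s t k i) z∣)
        (λ j → proj₁ (proj₂ (proj₂ (ess j))))
        (λ j → proj₂ (proj₂ (proj₂ (ess j))))
        (λ e → irredundant-closed cov ess e s t)
        (Search.certified⇒T n exponents window ok) i x∣

  module _ {m} (a b : Fin m → ℕ) where

    CoveringBelow : ℕ → Permutation′ m → Set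
    CoveringBelow n π = ∀ s t → ∃[ i ] toℕ i < n × N ∣ value a b s t (π ⟨$⟩ˡ i)

    OnlyBelow : ℕ → Permutation′ m → Fin m → ℕ → ℕ → Set
    OnlyBelow n π i s t = N ∣ value a b s t (π ⟨$⟩ˡ i) ×
      (∀ j → toℕ j < n → N ∣ value a b s t (π ⟨$⟩ˡ j) → j ≡ i)

    EssentialBelow : ℕ → Permutation′ m → Fin m → Set
    EssentialBelow n π i = ∃₂ (OnlyBelow n π i)

    value-% : ∀ s t i → ∃[ q ] value a b s t i ≡ q * N + value a b (s % N) (t % N) i
    value-% s t i = s / N * a i + t / N * b i , trans
      (cong₂ (λ s t → s * a i + t * b i) (m≡m%n+[m/n]*n s N) (m≡m%n+[m/n]*n t N))
      (lemma (s % N) (s / N) (t % N) (t / N) (a i) (b i) N)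
      where
      lemma : ∀ r q r₁ q₁ u v N →
              (r + q * N) * u + (r₁ + q₁ * N) * v ≡ (q * u + q₁ * v) * N + (r * u + r₁ * v)
      lemma = solve-∀

    ∣value⇒∣value-% : ∀ {s t} i → N ∣ value a b s t i → N ∣ value a b (s % N) (t % N) i
    ∣value⇒∣value-% {s} {t} i v∣ with q , eq ← value-% s t i =
      ∣m+n∣m⇒∣n (subst (N ∣_) eq v∣) (n∣m*n q)

    ∣value-%⇒∣value : ∀ {s t} i → N ∣ value a b (s % N) (t % N) i → N ∣ value a b s t i
    ∣value-%⇒∣value {s} {t} i v∣ with q , eq ← value-% s t i =
      subst (N ∣_) (sym eq) (∣m∣n⇒∣m+n (n∣m*n q) v∣)

    essentialBelow? : ∀ n π i → Dec (EssentialBelow n π i)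
    essentialBelow? n π i = ∃₂? N
      (λ s t → (N ∣? value a b s t (π ⟨$⟩ˡ i)) ×-dec
        all? λ j → (toℕ j <? n) →-dec ((N ∣? value a b s t (π ⟨$⟩ˡ j)) →-dec (j ≟ i)))
      (λ s t (v∣ , only) → ∣value⇒∣value-% (π ⟨$⟩ˡ i) v∣ ,
        λ j j<n w∣ → only j j<n (∣value-%⇒∣value (π ⟨$⟩ˡ j) w∣))

    -- A subgroup that is not essential is moved to the end by a transposition.
    drop-inessential : ∀ {n} (n<m : n < m) π i → toℕ i < suc n → ¬ EssentialBelow (suc n) π i →
                       CoveringBelow (suc n) π → CoveringBelow n (π ∘ₚ transpose i (fromℕ< n<m))
    drop-inessential {n} n<m π i i≤n ¬ess cov s t = relocate other
      where
      last : Fin m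
      last = fromℕ< n<m

      Other : Fin m → Set
      Other j = (toℕ j < suc n) × (N ∣ value a b s t (π ⟨$⟩ˡ j)) × (j ≢ i)

      below : ∀ j → toℕ j < suc n → j ≢ last → toℕ j < n
      below j (s≤s j≤n) j≢last = ≤∧≢⇒< j≤n λ j≡n →
        j≢last (toℕ-injective (trans j≡n (sym (toℕ-fromℕ< n<m))))

      other : ∃[ j ] Other j
      other with any? (λ j → (toℕ j <? suc n) ×-dec (N ∣? value a b s t (π ⟨$⟩ˡ j)) ×-dec ¬? (j ≟ i))
      ... | yes found = found
      ... | no ¬found = contradiction (s , t , atᵢ , onlyᵢ) ¬ess
        where
        onlyᵢ : ∀ j → toℕ j < suc n → N ∣ value a b s t (π ⟨$⟩ˡ j) → j ≡ i
        onlyᵢ j j≤n v∣ = decidable-stable (j ≟ i) λ j≢i → ¬found (j , j≤n , v∣ , j≢i)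

        atᵢ : N ∣ value a b s t (π ⟨$⟩ˡ i)
        atᵢ with j , j≤n , v∣ ← cov s t = subst (λ j → N ∣ value a b s t (π ⟨$⟩ˡ j)) (onlyᵢ j j≤n v∣) v∣

      relocate : ∃[ j ] Other j → ∃[ j ] toℕ j < n × N ∣ value a b s t (π ∘ₚ transpose i last ⟨$⟩ˡ j)
      relocate (j , j≤n , v∣ , j≢i) with j ≟ last
      ... | yes refl = i , below i i≤n (λ i≡last → j≢i (sym i≡last)) ,
        subst (λ k → N ∣ value a b s t (π ⟨$⟩ˡ k)) (sym swap) v∣
        where
        swap : transpose i last ⟨$⟩ˡ i ≡ last
        swap with i ≟ last
        ... | yes i≡last = i≡last
        ... | no _ with i ≟ i
        ...   | yes _ = refl
        ...   | no i≢i = contradiction refl i≢i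
      ... | no j≢last = j , below j j≤n j≢last ,
        subst (λ k → N ∣ value a b s t (π ⟨$⟩ˡ k)) (sym fix) v∣
        where
        fix : transpose i last ⟨$⟩ˡ j ≡ j
        fix with j ≟ last
        ... | yes j≡last = contradiction j≡last j≢last
        ... | no _ with j ≟ i
        ...   | yes j≡i = contradiction j≡i j≢i
        ...   | no _ = refl

    Irredundant : ℕ → Permutation′ m → Set
    Irredundant n π = CoveringBelow n π × (∀ i → toℕ i < n → EssentialBelow n π i)

    irredundant-subcovering : ∀ n π → n ≤ m → CoveringBelow n π →
                              ∃₂ λ n′ π′ → n′ ≤ m × Irredundant n′ π′
    irredundant-subcovering zero π n≤m cov = zero , π , n≤m , cov , λ i ()
    irredundant-subcovering (suc n) π n<m cov
      with all? (λ i → (toℕ i <? suc n) →-dec essentialBelow? (suc n) π i)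
    ... | yes ess = suc n , π , n<m , cov , ess
    ... | no ¬ess
      with i , ¬essᵢ ← ¬∀⟶∃¬ m _ (λ i → (toℕ i <? suc n) →-dec essentialBelow? (suc n) π i) ¬ess =
      irredundant-subcovering n (π ∘ₚ transpose i (fromℕ< n<m)) (≤-trans (n≤1+n n) n<m)
        (drop-inessential n<m π i
          (decidable-stable (toℕ i <? suc n) λ i≰n → ¬essᵢ λ i≤n → contradiction i≤n i≰n)
          (λ e → ¬essᵢ λ _ → e) cov)

    irredundant-exponent : ∀ {n} exponents window → Search.Certified n exponents window →
                           n ≤ m → ∀ {π} → Irredundant n π → ∀ s t →
                           ∃[ e ] e List.∈ exponents × (∀ i → toℕ i < n → N ∣ e * value a b s t (π ⟨$⟩ˡ i))
    irredundant-exponent {n} exponents window ok n≤m {π} (cov , ess) s t =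
      let e , e∈ , kills = covering-exponent (a ∘ι) (b ∘ι) exponents window ok cov′ ess′ s t
      in e , e∈ , λ i i<n → subst (λ i → N ∣ e * value a b s t (π ⟨$⟩ˡ i)) (ι-fromℕ< i i<n) (kills (fromℕ< i<n))
      where
      ι : Fin n → Fin m
      ι i = inject≤ i n≤m

      _∘ι : (Fin m → ℕ) → Fin n → ℕ
      (f ∘ι) i = f (π ⟨$⟩ˡ ι i)

      ι-fromℕ< : ∀ i (i<n : toℕ i < n) → ι (fromℕ< i<n) ≡ i
      ι-fromℕ< i i<n = toℕ-injective (trans (toℕ-inject≤ (fromℕ< i<n) n≤m) (toℕ-fromℕ< i<n))

      ι<n : ∀ i → toℕ (ι i) < n
      ι<n i = subst (_< n) (sym (toℕ-inject≤ i n≤m)) (toℕ<n i)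

      cov′ : Covering (a ∘ι) (b ∘ι)
      cov′ s t with i , i<n , v∣ ← cov s t =
        fromℕ< i<n , subst (λ i → N ∣ value a b s t (π ⟨$⟩ˡ i)) (sym (ι-fromℕ< i i<n)) v∣

      ess′ : ∀ i → Essential (a ∘ι) (b ∘ι) i
      ess′ i with s , t , v∣ , only ← ess (ι i) (ι<n i) =
        s , t , v∣ , λ j w∣ → inject≤-injective n≤m n≤m j i (only (ι j) (ι<n j) w∣)

-- Words and congruences of integers

infix 4 _≈[_]_
record _≈[_]_ (x : ℤ) (N : ℕ) (y : ℤ) : Set where
  constructor congruent
  field
    multiple : ℤ
    equality : x ≡ y ℤ.+ multiple ℤ.* + N

≈-reflexive : x ≡ y → x ≈[ N ] y
≈-reflexive {y = y} refl = congruent 0ℤ (sym (ℤ.+-identityʳ y))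

≈-sym : x ≈[ N ] y → y ≈[ N ] x
≈-sym {N = N} {y = y} (congruent q refl) = congruent (ℤ.- q) (lemma y q (+ N))
  where
  lemma : ∀ y q N → y ≡ y ℤ.+ q ℤ.* N ℤ.+ (ℤ.- q) ℤ.* N
  lemma = ℤ-solve-∀

≈-trans : x ≈[ N ] y → y ≈[ N ] z → x ≈[ N ] z
≈-trans {N = N} {z = z} (congruent p refl) (congruent q refl) = congruent (q ℤ.+ p) (lemma z p q (+ N))
  where
  lemma : ∀ z p q N → z ℤ.+ q ℤ.* N ℤ.+ p ℤ.* N ≡ z ℤ.+ (q ℤ.+ p) ℤ.* N
  lemma = ℤ-solve-∀

+-cong-≈ : x ≈[ N ] y → u ≈[ N ] v → x ℤ.+ u ≈[ N ] y ℤ.+ v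
+-cong-≈ {N = N} {y = y} {v = v} (congruent p refl) (congruent q refl) =
  congruent (p ℤ.+ q) (lemma y v p q (+ N))
  where
  lemma : ∀ y v p q N → y ℤ.+ p ℤ.* N ℤ.+ (v ℤ.+ q ℤ.* N) ≡ y ℤ.+ v ℤ.+ (p ℤ.+ q) ℤ.* N
  lemma = ℤ-solve-∀

*-congˡ-≈ : ∀ k → x ≈[ N ] y → k ℤ.* x ≈[ N ] k ℤ.* y
*-congˡ-≈ {N = N} {y = y} k (congruent q refl) = congruent (k ℤ.* q) (lemma k y q (+ N))
  where
  lemma : ∀ k y q N → k ℤ.* (y ℤ.+ q ℤ.* N) ≡ k ℤ.* y ℤ.+ k ℤ.* q ℤ.* N
  lemma = ℤ-solve-∀

*-scale-≈ : ∀ k → x ≈[ N ] y → + k ℤ.* x ≈[ k * N ] + k ℤ.* y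
*-scale-≈ {N = N} {y = y} k (congruent q refl) = congruent q (trans (lemma (+ k) y q (+ N))
  (cong (λ z → + k ℤ.* y ℤ.+ q ℤ.* z) (sym (ℤ.pos-* k N))))
  where
  lemma : ∀ k y q N → k ℤ.* (y ℤ.+ q ℤ.* N) ≡ k ℤ.* y ℤ.+ q ℤ.* (k ℤ.* N)
  lemma = ℤ-solve-∀

∣⇒≈0 : ∀ {k} → N ∣ k → + k ≈[ N ] 0ℤ
∣⇒≈0 {N} (divides q refl) = congruent (+ q) (trans (ℤ.pos-* q N) (sym (ℤ.+-identityˡ _)))

≈⇒∣ : ∀ d {k} → d ∣ N → + d ℤ.∣ y → + k ≈[ N ] y → d ∣ k
≈⇒∣ {N} {y} d {k} d∣N d∣y (congruent q eq) = ℤ.∣⇒∣ᵤ (subst (+ d ℤ.∣_) (sym eq)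
  (ℤ.∣m∣n⇒∣m+n d∣y (ℤ.∣n⇒∣m*n q (ℤ.∣ᵤ⇒∣ d∣N))))

toℕ-≈-injective : (i j : Fin N) → + toℕ i ≈[ N ] + toℕ j → i ≡ j
toℕ-≈-injective {N} i j i≈j = toℕ-injective (ℕ.≤-antisym (≤-of i j i≈j) (≤-of j i (≈-sym i≈j)))
  where
  ≤-of : (i j : Fin N) → + toℕ i ≈[ N ] + toℕ j → toℕ i ≤ toℕ j
  ≤-of i j (congruent q eq) with ℕ.≤-total (toℕ i) (toℕ j)
  ... | inj₁ i≤j = i≤j
  ... | inj₂ j≤i = ℕ.m∸n≡0⇒m≤n (small (toℕ i ∸ toℕ j) (ℕ.≤-<-trans (ℕ.m∸n≤m (toℕ i) (toℕ j)) (toℕ<n i)) N∣)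
    where
    small : ∀ k → k < N → N ∣ k → k ≡ 0
    small zero    _   _   = refl
    small (suc k) k<N N∣k with () ← >⇒∤ k<N N∣k

    N∣ : N ∣ toℕ i ∸ toℕ j
    N∣ = ℤ.∣⇒∣ᵤ (ℤ.divides q (trans (sym (ℤ.⊖-≥ j≤i)) (trans (sym (ℤ.m-n≡m⊖n (toℕ i) (toℕ j)))
      (trans (cong (ℤ._- + toℕ j) eq) (lemma (+ toℕ j) (q ℤ.* + N))))))
      where
      lemma : ∀ y z → y ℤ.+ z ℤ.- y ≡ z
      lemma = ℤ-solve-∀

module _ .{{_ : NonZero N}} where

  toℕ-mod : ∀ k → toℕ (k mod N) ≡ k % N
  toℕ-mod k = toℕ-fromℕ< (m%n<n k N)

  mod-≈ : ∀ k → + toℕ (k mod N) ≈[ N ] + k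
  mod-≈ k = ≈-sym (congruent (+ (k / N)) (trans (cong +_ (m≡m%n+[m/n]*n k N))
    (cong₂ ℤ._+_ (cong +_ (sym (toℕ-mod k))) (ℤ.pos-* (k / N) N))))

  residue : ℤ → Fin N
  residue z = fromℕ< (n%ℕd<d z N)

  residue-≈ : ∀ z → + toℕ (residue z) ≈[ N ] z
  residue-≈ z = ≈-sym (congruent (z /ℕ N) (trans (a≡a%ℕn+[a/ℕn]*n z N)
    (cong (λ k → + k ℤ.+ z /ℕ N ℤ.* + N) (sym (toℕ-fromℕ< (n%ℕd<d z N))))))

lookup-injective : ∀ {A : Set} {v w : Vec A n} → (∀ i → lookup v i ≡ lookup w i) → v ≡ w
lookup-injective {v = v} {w} eq = trans (sym (tabulate∘lookup v)) (trans (tabulate-cong eq) (tabulate∘lookup w))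

entry : Word N n → Fin n → ℤ
entry w i = + toℕ (lookup w i)

module _ .{{_ : NonZero N}} where

  entry-injective : {v w : Word N n} → (∀ i → entry v i ≈[ N ] entry w i) → v ≡ w
  entry-injective eq = lookup-injective λ i → toℕ-≈-injective _ _ (eq i)

  entry-0ʷ : ∀ i → entry (0ʷ {N} {n}) i ≈[ N ] 0ℤ
  entry-0ʷ {n} i = subst (λ x → + toℕ x ≈[ N ] 0ℤ) (sym (lookup-replicate {n = n} i (0# {N}))) (mod-≈ 0)

  entry-+ʷ : ∀ (v w : Word N n) i → entry (v +ʷ w) i ≈[ N ] entry v i ℤ.+ entry w i
  entry-+ʷ v w i rewrite lookup-zipWith _+ᴺ_ i v w = mod-≈ (toℕ (lookup v i) + toℕ (lookup w i))

  entry-*ʷ : ∀ a (w : Word N n) i → entry (a *ʷ w) i ≈[ N ] + toℕ a ℤ.* entry w i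
  entry-*ʷ a w i rewrite lookup-map i (a *ᴺ_) w =
    subst (+ toℕ (a *ᴺ lookup w i) ≈[ N ]_) (ℤ.pos-* (toℕ a) (toℕ (lookup w i)))
      (mod-≈ (toℕ a * toℕ (lookup w i)))

-- The coefficients are integers, so that identities between them are ring identities.
Spanned : (r r′ : Fin n → ℤ) → (Fin n → ℤ) → ℕ → Set
Spanned r r′ w N = ∃₂ λ s t → ∀ i → w i ≈[ N ] s ℤ.* r i ℤ.+ t ℤ.* r′ i

module _ .{{_ : NonZero N}} (r r′ : Word N n) where

  combination-≈ : ∀ a b i → entry (combination (a ∷ b ∷ []) (r ∷ r′ ∷ [])) i ≈[ N ]
                            + toℕ a ℤ.* entry r i ℤ.+ + toℕ b ℤ.* entry r′ i
  combination-≈ a b i = ≈-trans (entry-+ʷ (a *ʷ r) ((b *ʷ r′) +ʷ 0ʷ) i) (+-cong-≈ (entry-*ʷ a r i)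
    (≈-trans (entry-+ʷ (b *ʷ r′) 0ʷ i) (≈-trans (+-cong-≈ (entry-*ʷ b r′ i) (entry-0ʷ {n = n} i))
      (≈-reflexive (ℤ.+-identityʳ _)))))

  rowSpan⇒spanned : ∀ {w} → w ∈ rowSpan (r ∷ r′ ∷ []) → Spanned (entry r) (entry r′) (entry w) N
  rowSpan⇒spanned (a ∷ b ∷ [] , refl) = + toℕ a , + toℕ b , combination-≈ a b

  spanned⇒rowSpan : ∀ {w} → Spanned (entry r) (entry r′) (entry w) N → w ∈ rowSpan (r ∷ r′ ∷ [])
  spanned⇒rowSpan (s , t , eq) = residue s ∷ residue t ∷ [] , entry-injective λ i → ≈-trans (eq i)
    (≈-sym (≈-trans (combination-≈ (residue s) (residue t) i)
      (+-cong-≈ (swap (residue-≈ s) i r) (swap (residue-≈ t) i r′))))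
    where
    swap : ∀ {s s′} → s ≈[ N ] s′ → ∀ i (r : Word N n) → s ℤ.* entry r i ≈[ N ] s′ ℤ.* entry r i
    swap {s} {s′} s≈ i r = subst₂ (_≈[ N ]_) (ℤ.*-comm (entry r i) s) (ℤ.*-comm (entry r i) s′)
      (*-congˡ-≈ (entry r i) s≈)

  rowSpan-linear : IsLinear (rowSpan (r ∷ r′ ∷ []))
  rowSpan-linear = record
    { 0-closed = spanned⇒rowSpan (0ℤ , 0ℤ , λ i → ≈-trans (entry-0ʷ {n = n} i)
        (≈-reflexive (lemma₀ (entry r i) (entry r′ i))))
    ; +-closed = λ {v} {w} v∈ w∈ →
        let s , t , eq = rowSpan⇒spanned v∈
            s₁ , t₁ , eq₁ = rowSpan⇒spanned w∈
        in spanned⇒rowSpan (s ℤ.+ s₁ , t ℤ.+ t₁ , λ i → ≈-trans (entry-+ʷ v w i)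
          (≈-trans (+-cong-≈ (eq i) (eq₁ i))
            (≈-reflexive (lemma₊ s t s₁ t₁ (entry r i) (entry r′ i)))))
    ; *-closed = λ a {w} w∈ →
        let s , t , eq = rowSpan⇒spanned w∈
        in spanned⇒rowSpan (+ toℕ a ℤ.* s , + toℕ a ℤ.* t , λ i → ≈-trans (entry-*ʷ a w i)
          (≈-trans (*-congˡ-≈ (+ toℕ a) (eq i))
            (≈-reflexive (lemma* (+ toℕ a) s t (entry r i) (entry r′ i)))))
    }
    where
    lemma₀ : ∀ u v → 0ℤ ≡ 0ℤ ℤ.* u ℤ.+ 0ℤ ℤ.* v
    lemma₀ = ℤ-solve-∀

    lemma₊ : ∀ s t s₁ t₁ u v → s ℤ.* u ℤ.+ t ℤ.* v ℤ.+ (s₁ ℤ.* u ℤ.+ t₁ ℤ.* v) ≡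
                               (s ℤ.+ s₁) ℤ.* u ℤ.+ (t ℤ.+ t₁) ℤ.* v
    lemma₊ = ℤ-solve-∀

    lemma* : ∀ a s t u v → a ℤ.* (s ℤ.* u ℤ.+ t ℤ.* v) ≡ a ℤ.* s ℤ.* u ℤ.+ a ℤ.* t ℤ.* v
    lemma* = ℤ-solve-∀

spanned-mono : ∀ {r r′ g g′ : Fin n → ℤ} {w} →
               (∀ s t → ∃₂ λ σ τ → ∀ i → s ℤ.* r i ℤ.+ t ℤ.* r′ i ≈[ N ] σ ℤ.* g i ℤ.+ τ ℤ.* g′ i) →
               Spanned r r′ w N → Spanned g g′ w N
spanned-mono incl (s , t , eq) with σ , τ , eq′ ← incl s t = σ , τ , λ i → ≈-trans (eq i) (eq′ i)

spanned-cong : ∀ {r r′ g g′ : Fin n → ℤ} {w} → (∀ i → r i ≈[ N ] g i) → (∀ i → r′ i ≈[ N ] g′ i) →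
               Spanned r r′ w N → Spanned g g′ w N
spanned-cong r≈ r′≈ = spanned-mono λ s t → s , t , λ i → +-cong-≈ (*-congˡ-≈ s (r≈ i)) (*-congˡ-≈ t (r′≈ i))

-- The two codes with three columns in {0 , h}

thinRow₁ thinRow₂ : ℕ → Fin 5 → ℤ
thinRow₁ h = lookup (+ h ∷ + h ∷ 0ℤ ∷ 0ℤ ∷ 0ℤ ∷ [])
thinRow₂ h = lookup (+ h ∷ 0ℤ ∷ + h ∷ 1ℤ ∷ -1ℤ ∷ [])

det-parity : ∀ α₁ β₁ {α₂ β₂ c d} → c ≈[ 2 ] α₂ → d ≈[ 2 ] β₂ → α₁ ℤ.* β₂ ℤ.+ β₁ ℤ.* α₂ ≈[ 2 ] 1ℤ →
             α₁ ℤ.* d ℤ.- β₁ ℤ.* c ≈[ 2 ] 1ℤ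
det-parity α₁ β₁ {α₂} {β₂} (congruent p refl) (congruent q refl) (congruent r eq) =
  congruent (r ℤ.+ α₁ ℤ.* q ℤ.- β₁ ℤ.* p ℤ.- β₁ ℤ.* α₂)
    (trans (lemma α₁ α₂ β₁ β₂ p q) (trans (cong (ℤ._+ (α₁ ℤ.* q ℤ.- β₁ ℤ.* p ℤ.- β₁ ℤ.* α₂) ℤ.* + 2) eq)
      (lemma′ α₁ α₂ β₁ p q r)))
  where
  lemma : ∀ α₁ α₂ β₁ β₂ p q → α₁ ℤ.* (β₂ ℤ.+ q ℤ.* + 2) ℤ.- β₁ ℤ.* (α₂ ℤ.+ p ℤ.* + 2) ≡
          α₁ ℤ.* β₂ ℤ.+ β₁ ℤ.* α₂ ℤ.+ (α₁ ℤ.* q ℤ.- β₁ ℤ.* p ℤ.- β₁ ℤ.* α₂) ℤ.* + 2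
  lemma = ℤ-solve-∀

  lemma′ : ∀ α₁ α₂ β₁ p q r → 1ℤ ℤ.+ r ℤ.* + 2 ℤ.+ (α₁ ℤ.* q ℤ.- β₁ ℤ.* p ℤ.- β₁ ℤ.* α₂) ℤ.* + 2 ≡
           1ℤ ℤ.+ (r ℤ.+ α₁ ℤ.* q ℤ.- β₁ ℤ.* p ℤ.- β₁ ℤ.* α₂) ℤ.* + 2
  lemma′ = ℤ-solve-∀

-- The code of all words (α·x h , χ·x , -χ·x), x ∈ ℤ², where α has three columns, over
-- ℤ/2h. The parity of χ·x is that of α₂·x, so the word is determined by σ = α₁·x and
-- τ = χ·x, and every pair (σ mod 2 , τ mod 2h) occurs: (u , v) has τ = 1, and (d , -c)
-- has τ = 0 and odd σ.
module ThinForm (h : ℕ) (α β : Fin 3 → ℤ) (c d u v : ℤ)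
  (sum-α  : α 0F ℤ.+ α 1F ℤ.+ α 2F ≈[ 2 ] 0ℤ)
  (sum-β  : β 0F ℤ.+ β 1F ℤ.+ β 2F ≈[ 2 ] 0ℤ)
  (c-parity : c ≈[ 2 ] α 2F)
  (d-parity : d ≈[ 2 ] β 2F)
  (det-odd  : α 1F ℤ.* β 2F ℤ.+ β 1F ℤ.* α 2F ≈[ 2 ] 1ℤ)
  (bezout   : u ℤ.* c ℤ.+ v ℤ.* d ≈[ h * 2 ] 1ℤ)
  where

  private
    g  = thinRow₁ h
    g′ = thinRow₂ h

  record Columns (A B : Fin 5 → ℤ) : Set where
    field
      A₀ : A 0F ≡ + h ℤ.* α 0F
      A₁ : A 1F ≡ + h ℤ.* α 1F
      A₂ : A 2F ≡ + h ℤ.* α 2F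
      A₃ : A 3F ≡ c
      A₄ : A 4F ≈[ h * 2 ] ℤ.- c
      B₀ : B 0F ≡ + h ℤ.* β 0F
      B₁ : B 1F ≡ + h ℤ.* β 1F
      B₂ : B 2F ≡ + h ℤ.* β 2F
      B₃ : B 3F ≡ d
      B₄ : B 4F ≈[ h * 2 ] ℤ.- d

  parity-step : ∀ {x y z e} → x ℤ.+ y ℤ.+ z ≈[ 2 ] 0ℤ → e ≈[ 2 ] z → x ≈[ 2 ] y ℤ.+ e
  parity-step {x} {y} {z} (congruent p eq) (congruent q refl) = congruent (p ℤ.- y ℤ.- z ℤ.- q)
    (trans (lemma x y z) (trans (cong (λ w → w ℤ.- y ℤ.- z) eq) (lemma′ y z p q)))
    where
    lemma : ∀ x y z → x ≡ x ℤ.+ y ℤ.+ z ℤ.- y ℤ.- z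
    lemma = ℤ-solve-∀

    lemma′ : ∀ y z p q → 0ℤ ℤ.+ p ℤ.* + 2 ℤ.- y ℤ.- z ≡ y ℤ.+ (z ℤ.+ q ℤ.* + 2) ℤ.+ (p ℤ.- y ℤ.- z ℤ.- q) ℤ.* + 2
    lemma′ = ℤ-solve-∀

  det′-odd : α 1F ℤ.* d ℤ.- β 1F ℤ.* c ≈[ 2 ] 1ℤ
  det′-odd = det-parity (α 1F) (β 1F) c-parity d-parity det-odd

  module _ {A B : Fin 5 → ℤ} (columns : Columns A B) where
    open Columns columns

    word≈ : ∀ s t i → s ℤ.* A i ℤ.+ t ℤ.* B i ≈[ h * 2 ]
            (s ℤ.* α 1F ℤ.+ t ℤ.* β 1F) ℤ.* g i ℤ.+ (s ℤ.* c ℤ.+ t ℤ.* d) ℤ.* g′ i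
    word≈ s t 0F rewrite A₀ | B₀ = ≈-trans (≈-reflexive (lemma s t (+ h) (α 0F) (β 0F)))
      (≈-trans (*-scale-≈ h (+-cong-≈ (*-congˡ-≈ s (parity-step sum-α c-parity))
                                      (*-congˡ-≈ t (parity-step sum-β d-parity))))
        (≈-reflexive (lemma′ s t (+ h) (α 1F) (β 1F) c d)))
      where
      lemma : ∀ s t h x y → s ℤ.* (h ℤ.* x) ℤ.+ t ℤ.* (h ℤ.* y) ≡ h ℤ.* (s ℤ.* x ℤ.+ t ℤ.* y)
      lemma = ℤ-solve-∀

      lemma′ : ∀ s t h x y c d → h ℤ.* (s ℤ.* (x ℤ.+ c) ℤ.+ t ℤ.* (y ℤ.+ d)) ≡
               (s ℤ.* x ℤ.+ t ℤ.* y) ℤ.* h ℤ.+ (s ℤ.* c ℤ.+ t ℤ.* d) ℤ.* h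
      lemma′ = ℤ-solve-∀
    word≈ s t 1F rewrite A₁ | B₁ = ≈-reflexive (lemma s t (+ h) (α 1F) (β 1F) c d)
      where
      lemma : ∀ s t h x y c d → s ℤ.* (h ℤ.* x) ℤ.+ t ℤ.* (h ℤ.* y) ≡
              (s ℤ.* x ℤ.+ t ℤ.* y) ℤ.* h ℤ.+ (s ℤ.* c ℤ.+ t ℤ.* d) ℤ.* 0ℤ
      lemma = ℤ-solve-∀
    word≈ s t 2F rewrite A₂ | B₂ = ≈-trans (≈-reflexive (lemma s t (+ h) (α 2F) (β 2F)))
      (≈-trans (*-scale-≈ h (+-cong-≈ (*-congˡ-≈ s (≈-sym c-parity)) (*-congˡ-≈ t (≈-sym d-parity))))
        (≈-reflexive (lemma′ (s ℤ.* α 1F ℤ.+ t ℤ.* β 1F) s t (+ h) c d)))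
      where
      lemma : ∀ s t h x y → s ℤ.* (h ℤ.* x) ℤ.+ t ℤ.* (h ℤ.* y) ≡ h ℤ.* (s ℤ.* x ℤ.+ t ℤ.* y)
      lemma = ℤ-solve-∀

      lemma′ : ∀ z s t h c d → h ℤ.* (s ℤ.* c ℤ.+ t ℤ.* d) ≡ z ℤ.* 0ℤ ℤ.+ (s ℤ.* c ℤ.+ t ℤ.* d) ℤ.* h
      lemma′ = ℤ-solve-∀
    word≈ s t 3F rewrite A₃ | B₃ = ≈-reflexive (lemma (s ℤ.* α 1F ℤ.+ t ℤ.* β 1F) (s ℤ.* c ℤ.+ t ℤ.* d))
      where
      lemma : ∀ x y → y ≡ x ℤ.* 0ℤ ℤ.+ y ℤ.* 1ℤ
      lemma = ℤ-solve-∀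
    word≈ s t 4F = ≈-trans (+-cong-≈ (*-congˡ-≈ s A₄) (*-congˡ-≈ t B₄))
      (≈-reflexive (lemma (s ℤ.* α 1F ℤ.+ t ℤ.* β 1F) s t c d))
      where
      lemma : ∀ x s t c d → s ℤ.* (ℤ.- c) ℤ.+ t ℤ.* (ℤ.- d) ≡ x ℤ.* 0ℤ ℤ.+ (s ℤ.* c ℤ.+ t ℤ.* d) ℤ.* -1ℤ
      lemma = ℤ-solve-∀

    thin-cong : ∀ {σ σ₁ τ τ₁} → σ ≈[ 2 ] σ₁ → τ ≈[ h * 2 ] τ₁ → ∀ i →
                σ ℤ.* g i ℤ.+ τ ℤ.* g′ i ≈[ h * 2 ] σ₁ ℤ.* g i ℤ.+ τ₁ ℤ.* g′ i
    thin-cong {σ} {σ₁} {τ} {τ₁} σ≈ τ≈ i = +-cong-≈ (at i)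
      (subst₂ (_≈[ h * 2 ]_) (ℤ.*-comm (g′ i) τ) (ℤ.*-comm (g′ i) τ₁) (*-congˡ-≈ (g′ i) τ≈))
      where
      scaled : σ ℤ.* + h ≈[ h * 2 ] σ₁ ℤ.* + h
      scaled = subst₂ (_≈[ h * 2 ]_) (ℤ.*-comm (+ h) σ) (ℤ.*-comm (+ h) σ₁) (*-scale-≈ h σ≈)

      killed : σ ℤ.* 0ℤ ≈[ h * 2 ] σ₁ ℤ.* 0ℤ
      killed = ≈-reflexive (trans (ℤ.*-zeroʳ σ) (sym (ℤ.*-zeroʳ σ₁)))

      at : ∀ i → σ ℤ.* g i ≈[ h * 2 ] σ₁ ℤ.* g i
      at 0F = scaled
      at 1F = scaled
      at 2F = killed
      at 3F = killed
      at 4F = killed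

    spanned⇒thin : ∀ {w} → Spanned A B w (h * 2) → Spanned g g′ w (h * 2)
    spanned⇒thin = spanned-mono λ s t →
      s ℤ.* α 1F ℤ.+ t ℤ.* β 1F , s ℤ.* c ℤ.+ t ℤ.* d , word≈ s t

    thin⇒spanned : ∀ {w} → Spanned g g′ w (h * 2) → Spanned A B w (h * 2)
    thin⇒spanned = spanned-mono λ σ τ →
      let ρ = α 1F ℤ.* (τ ℤ.* u) ℤ.+ β 1F ℤ.* (τ ℤ.* v)
          ε = σ ℤ.- ρ
          s = τ ℤ.* u ℤ.+ ε ℤ.* d
          t = τ ℤ.* v ℤ.- ε ℤ.* c
          σ≈ : s ℤ.* α 1F ℤ.+ t ℤ.* β 1F ≈[ 2 ] σ
          σ≈ = ≈-trans (≈-reflexive (lemma (τ ℤ.* u) (τ ℤ.* v) ε c d (α 1F) (β 1F)))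
            (≈-trans (+-cong-≈ (≈-reflexive {x = ρ} refl) (*-congˡ-≈ ε det′-odd))
              (≈-reflexive (lemma′ σ (τ ℤ.* u) (τ ℤ.* v) (α 1F) (β 1F))))
          τ≈ : s ℤ.* c ℤ.+ t ℤ.* d ≈[ h * 2 ] τ
          τ≈ = ≈-trans (≈-reflexive (lemma″ τ u v ε c d))
            (≈-trans (*-congˡ-≈ τ bezout) (≈-reflexive (ℤ.*-identityʳ τ)))
      in s , t , λ i → ≈-sym (≈-trans (word≈ s t i) (thin-cong σ≈ τ≈ i))
      where
      lemma : ∀ x y ε c d α β → (x ℤ.+ ε ℤ.* d) ℤ.* α ℤ.+ (y ℤ.- ε ℤ.* c) ℤ.* β ≡
              α ℤ.* x ℤ.+ β ℤ.* y ℤ.+ ε ℤ.* (α ℤ.* d ℤ.- β ℤ.* c)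
      lemma = ℤ-solve-∀

      lemma′ : ∀ σ x y α β → α ℤ.* x ℤ.+ β ℤ.* y ℤ.+ (σ ℤ.- (α ℤ.* x ℤ.+ β ℤ.* y)) ℤ.* 1ℤ ≡ σ
      lemma′ = ℤ-solve-∀

      lemma″ : ∀ τ u v ε c d → (τ ℤ.* u ℤ.+ ε ℤ.* d) ℤ.* c ℤ.+ (τ ℤ.* v ℤ.- ε ℤ.* c) ℤ.* d ≡
               τ ℤ.* (u ℤ.* c ℤ.+ v ℤ.* d)
      lemma″ = ℤ-solve-∀

module _ {C : Code N n} .{{_ : NonZero N}} {A B : Fin n → ℤ} (π : Permutation′ n)
  (∈C⇔ : ∀ w → w ∈ C ⇔ Spanned A B (entry w) N) where

  ∈C⇔-permuted : ∀ w → w ∈ C ⇔ Spanned (A ∘ (π ⟨$⟩ˡ_)) (B ∘ (π ⟨$⟩ˡ_)) (entry (permute π w)) N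
  ∈C⇔-permuted w = mk⇔
    (λ w∈ → let s , t , eq = Equivalence.to (∈C⇔ w) w∈ in s , t , λ i →
      subst (λ x → + toℕ x ≈[ N ] s ℤ.* A (π ⟨$⟩ˡ i) ℤ.+ t ℤ.* B (π ⟨$⟩ˡ i))
        (sym (lookup∘tabulate _ i)) (eq (π ⟨$⟩ˡ i)))
    (λ (s , t , eq) → Equivalence.from (∈C⇔ w) (s , t , λ i →
      subst (λ j → entry w j ≈[ N ] s ℤ.* A j ℤ.+ t ℤ.* B j) (inverseˡ π)
        (subst (λ x → + toℕ x ≈[ N ] s ℤ.* A (π ⟨$⟩ˡ (π ⟨$⟩ʳ i)) ℤ.+ t ℤ.* B (π ⟨$⟩ˡ (π ⟨$⟩ʳ i)))
          (lookup∘tabulate _ (π ⟨$⟩ʳ i)) (eq (π ⟨$⟩ʳ i)))))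

-- For odd h, the Chinese remainder theorem makes the coefficients of the columns divisible
-- by h (which matter modulo 2 only) independent of those of the even columns.
module SplitColumns (N h q : ℕ) .{{_ : NonZero N}} .{{_ : NonZero h}} (N≡ : N ≡ h * 2) (h-odd : h ≡ 1 + q * 2)
  (α β : Fin 3 → ℤ) (γ δ : Fin 2 → ℤ) where

  column : ℤ → (Fin 3 → ℤ) → (Fin 2 → ℤ) → Fin 5 → ℤ
  column k α γ 0F = k ℤ.* α 0F
  column k α γ 1F = k ℤ.* α 1F
  column k α γ 2F = k ℤ.* α 2F
  column k α γ 3F = + 2 ℤ.* γ 0F
  column k α γ 4F = + 2 ℤ.* γ 1F

  lcm≡ : N ≡ lcm 2 h
  lcm≡ = begin
    N                   ≡⟨ N≡ ⟩
    h * 2               ≡⟨ ℕ.*-comm h 2 ⟩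
    2 * h               ≡⟨ gcd*lcm 2 h ⟨
    gcd 2 h * lcm 2 h   ≡⟨ cong (_* lcm 2 h) gcd≡1 ⟩
    1 * lcm 2 h         ≡⟨ ℕ.*-identityˡ _ ⟩
    lcm 2 h             ∎
    where
    open ≡-Reasoning
    gcd≡1 : gcd 2 h ≡ 1
    gcd≡1 = ∣1⇒≡1 (∣m+n∣m⇒∣n
      (subst (gcd 2 h ∣_) (trans h-odd (ℕ.+-comm 1 (q * 2))) (gcd[m,n]∣n 2 h))
      (∣n⇒∣m*n q (gcd[m,n]∣m 2 h)))

  C₁ : Code 2 3
  C₁ = rowSpan (tabulate (λ i → residue (α i)) ∷ tabulate (λ i → residue (β i)) ∷ [])

  C₂ : Code h 2
  C₂ = rowSpan (tabulate (λ i → residue (γ i)) ∷ tabulate (λ i → residue (δ i)) ∷ [])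

  module _ {M n} .{{_ : NonZero M}} (r r′ : Fin n → ℤ) where

    row≈ : ∀ (r : Fin n → ℤ) i → entry (tabulate (λ i → residue {M} (r i))) i ≈[ M ] r i
    row≈ r i rewrite lookup∘tabulate (λ i → residue {M} (r i)) i = residue-≈ (r i)

    ∈residues⇒ : ∀ {w : Word M n} →
                 w ∈ rowSpan (tabulate (λ i → residue (r i)) ∷ tabulate (λ i → residue (r′ i)) ∷ []) →
                 Spanned r r′ (entry w) M
    ∈residues⇒ w∈ = spanned-mono (λ s t → s , t , λ i → +-cong-≈ (*-congˡ-≈ s (row≈ r i)) (*-congˡ-≈ t (row≈ r′ i)))
      (rowSpan⇒spanned _ _ w∈)

    ∈residues : ∀ s t → tabulate (λ i → residue {M} (s ℤ.* r i ℤ.+ t ℤ.* r′ i)) ∈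
                rowSpan (tabulate (λ i → residue (r i)) ∷ tabulate (λ i → residue (r′ i)) ∷ [])
    ∈residues s t = spanned⇒rowSpan _ _ (s , t , λ i → ≈-trans (row≈ (λ i → s ℤ.* r i ℤ.+ t ℤ.* r′ i) i)
      (≈-sym (+-cong-≈ (*-congˡ-≈ s (row≈ r i)) (*-congˡ-≈ t (row≈ r′ i)))))

  rescale-≈ : ∀ {M} .{{_ : NonZero M}} k → N ≡ k * M → ∀ {x : Fin M} {z} → + toℕ x ≈[ M ] z →
              + toℕ (rescale N x) ≈[ N ] + k ℤ.* z
  rescale-≈ {M} k N≡kM {x} {z} x≈z = ≈-trans (mod-≈ (N / M * toℕ x))
    (≈-trans (≈-reflexive (trans (ℤ.pos-* (N / M) (toℕ x)) (cong (λ j → + j ℤ.* + toℕ x)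
        (trans (cong (_/ M) N≡kM) (m*n/n≡m k M)))))
      (subst (λ N → + k ℤ.* + toℕ x ≈[ N ] + k ℤ.* z) (sym N≡kM) (*-scale-≈ k x≈z)))

  N≡′ : N ≡ 2 * h
  N≡′ = trans N≡ (ℕ.*-comm h 2)

  h-odd-ℤ : + h ≡ 1ℤ ℤ.+ + q ℤ.* + 2
  h-odd-ℤ = trans (cong +_ h-odd) (cong (ℤ._+_ 1ℤ) (ℤ.pos-* q 2))

  *-distrib-combination : ∀ k s t a b → k ℤ.* (s ℤ.* a ℤ.+ t ℤ.* b) ≡ s ℤ.* (k ℤ.* a) ℤ.+ t ℤ.* (k ℤ.* b)
  *-distrib-combination = ℤ-solve-∀

  isDirectSum : ∀ {C : Code N 5} (π : Permutation′ 5) →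
                (∀ w → w ∈ C ⇔ Spanned (column (+ h) α γ) (column (+ h) β δ) (entry (permute π w)) N) →
                IsDirectSum C
  isDirectSum {C} π ∈C⇔ = record
    { N≡lcm = lcm≡
    ; C₁ = C₁
    ; C₂ = C₂
    ; C₁-linear = rowSpan-linear _ _
    ; C₂-linear = rowSpan-linear _ _
    ; C≅C₁⊕C₂ = π , λ w → mk⇔
        (λ w∈ → split (permute π w) (Equivalence.to (∈C⇔ w) w∈))
        (λ w∈ → Equivalence.from (∈C⇔ w) (join (permute π w) w∈))
    }
    where
    split : ∀ w → Spanned (column (+ h) α γ) (column (+ h) β δ) (entry w) N → w ∈ directSum N lcm≡ C₁ C₂
    split w (s , t , eq) = c₁ , c₂ , ∈residues α β s t , ∈residues γ δ s t ,
      entry-injective λ i → ≈-trans (eq i) (≈-sym (at i))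
      where
      c₁ : Word 2 3
      c₁ = tabulate (λ i → residue (s ℤ.* α i ℤ.+ t ℤ.* β i))

      c₂ : Word h 2
      c₂ = tabulate (λ i → residue (s ℤ.* γ i ℤ.+ t ℤ.* δ i))

      at₁ : ∀ i → + toℕ (rescale N (residue {2} (s ℤ.* α i ℤ.+ t ℤ.* β i))) ≈[ N ]
                  s ℤ.* (+ h ℤ.* α i) ℤ.+ t ℤ.* (+ h ℤ.* β i)
      at₁ i = ≈-trans (rescale-≈ h N≡ (residue-≈ _)) (≈-reflexive (*-distrib-combination (+ h) s t (α i) (β i)))

      at₂ : ∀ i → + toℕ (rescale N (residue {h} (s ℤ.* γ i ℤ.+ t ℤ.* δ i))) ≈[ N ]
                  s ℤ.* (+ 2 ℤ.* γ i) ℤ.+ t ℤ.* (+ 2 ℤ.* δ i)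
      at₂ i = ≈-trans (rescale-≈ 2 N≡′ (residue-≈ _)) (≈-reflexive (*-distrib-combination (+ 2) s t (γ i) (δ i)))

      at : ∀ i → entry (map (rescale N) c₁ ++ map (rescale N) c₂) i ≈[ N ]
                 s ℤ.* column (+ h) α γ i ℤ.+ t ℤ.* column (+ h) β δ i
      at 0F = at₁ 0F
      at 1F = at₁ 1F
      at 2F = at₁ 2F
      at 3F = at₂ 0F
      at 4F = at₂ 1F

    join : ∀ w → w ∈ directSum N lcm≡ C₁ C₂ → Spanned (column (+ h) α γ) (column (+ h) β δ) (entry w) N
    join _ (c₁@(_ ∷ _ ∷ _ ∷ []) , c₂@(_ ∷ _ ∷ []) , c₁∈ , c₂∈ , refl)
      with s₁ , t₁ , eq₁ ← ∈residues⇒ α β {c₁} c₁∈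
      with s₂ , t₂ , eq₂ ← ∈residues⇒ γ δ {c₂} c₂∈ = s , t , at
      where
      crt : ℤ → ℤ → ℤ
      crt x y = x ℤ.* + h ℤ.+ y ℤ.* (+ h ℤ.+ 1ℤ)

      s t : ℤ
      s = crt s₁ s₂
      t = crt t₁ t₂

      crt-2 : ∀ x y a → x ℤ.* a ≈[ 2 ] crt x y ℤ.* a
      crt-2 x y a = ≈-sym (congruent ((x ℤ.* + q ℤ.+ y ℤ.* (+ q ℤ.+ 1ℤ)) ℤ.* a)
        (subst (λ k → (x ℤ.* k ℤ.+ y ℤ.* (k ℤ.+ 1ℤ)) ℤ.* a ≡
                      x ℤ.* a ℤ.+ (x ℤ.* + q ℤ.+ y ℤ.* (+ q ℤ.+ 1ℤ)) ℤ.* a ℤ.* + 2)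
          (sym h-odd-ℤ) (lemma x y a (+ q))))
        where
        lemma : ∀ x y a q → (x ℤ.* (1ℤ ℤ.+ q ℤ.* + 2) ℤ.+ y ℤ.* (1ℤ ℤ.+ q ℤ.* + 2 ℤ.+ 1ℤ)) ℤ.* a ≡
                x ℤ.* a ℤ.+ (x ℤ.* q ℤ.+ y ℤ.* (q ℤ.+ 1ℤ)) ℤ.* a ℤ.* + 2
        lemma = ℤ-solve-∀

      crt-h : ∀ x y a → y ℤ.* a ≈[ h ] crt x y ℤ.* a
      crt-h x y a = ≈-sym (congruent ((x ℤ.+ y) ℤ.* a) (lemma x y a (+ h)))
        where
        lemma : ∀ x y a h → (x ℤ.* h ℤ.+ y ℤ.* (h ℤ.+ 1ℤ)) ℤ.* a ≡ y ℤ.* a ℤ.+ (x ℤ.+ y) ℤ.* a ℤ.* h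
        lemma = ℤ-solve-∀

      at₁ : ∀ i → + toℕ (rescale N (lookup c₁ i)) ≈[ N ] s ℤ.* (+ h ℤ.* α i) ℤ.+ t ℤ.* (+ h ℤ.* β i)
      at₁ i = ≈-trans
        (rescale-≈ h N≡ (≈-trans (eq₁ i) (+-cong-≈ (crt-2 s₁ s₂ (α i)) (crt-2 t₁ t₂ (β i)))))
        (≈-reflexive (*-distrib-combination (+ h) s t (α i) (β i)))

      at₂ : ∀ i → + toℕ (rescale N (lookup c₂ i)) ≈[ N ] s ℤ.* (+ 2 ℤ.* γ i) ℤ.+ t ℤ.* (+ 2 ℤ.* δ i)
      at₂ i = ≈-trans
        (rescale-≈ 2 N≡′ (≈-trans (eq₂ i) (+-cong-≈ (crt-h s₁ s₂ (γ i)) (crt-h t₁ t₂ (δ i)))))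
        (≈-reflexive (*-distrib-combination (+ 2) s t (γ i) (δ i)))

      at : ∀ i → entry (map (rescale N) c₁ ++ map (rescale N) c₂) i ≈[ N ]
                 s ℤ.* column (+ h) α γ i ℤ.+ t ℤ.* column (+ h) β δ i
      at 0F = at₁ 0F
      at 1F = at₁ 1F
      at 2F = at₁ 2F
      at 3F = at₂ 0F
      at 4F = at₂ 1F

-- Greatest common divisors, parities, the plane over 𝔽₂

gcds : (Fin n → ℕ) → ℕ
gcds {zero}  f = 0
gcds {suc n} f = gcd (f zero) (gcds (f ∘ suc))

gcds∣ : (f : Fin n → ℕ) → ∀ i → gcds f ∣ f i
gcds∣ f zero    = gcd[m,n]∣m (f zero) _
gcds∣ f (suc i) = ∣-trans (gcd[m,n]∣n (f zero) _) (gcds∣ (f ∘ suc) i)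

∣*gcd : ∀ e k l {d} → d ∣ e * k → d ∣ e * l → d ∣ e * gcd k l
∣*gcd e k l {d} p q = subst (d ∣_) (sym (c*gcd[m,n]≡gcd[cm,cn] e k l)) (gcd-greatest p q)

∣*gcds : ∀ e {d} (f : Fin n → ℕ) → (∀ i → d ∣ e * f i) → d ∣ e * gcds f
∣*gcds {zero}  e {d} f p = subst (d ∣_) (sym (ℕ.*-zeroʳ e)) (d ∣0)
∣*gcds {suc n} e f p = ∣*gcd e (f zero) _ (p zero) (∣*gcds e (f ∘ suc) (p ∘ suc))

bézout : ∀ m n → ∃₂ λ u v → u ℤ.* + m ℤ.+ v ℤ.* + n ≡ + gcd m n
bézout m n with Bézout.identity (gcd-GCD m n)
... | Bézout.+- x y eq = + x , ℤ.- + y , (begin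
  + x ℤ.* + m ℤ.+ (ℤ.- + y) ℤ.* + n          ≡⟨ cong (ℤ._+ (ℤ.- + y) ℤ.* + n) (ℤ.pos-* x m) ⟨
  + (x * m) ℤ.+ (ℤ.- + y) ℤ.* + n            ≡⟨ cong (λ k → + k ℤ.+ (ℤ.- + y) ℤ.* + n) eq ⟨
  + gcd m n ℤ.+ + (y * n) ℤ.+ (ℤ.- + y) ℤ.* + n ≡⟨ cong (λ z → + gcd m n ℤ.+ z ℤ.+ (ℤ.- + y) ℤ.* + n) (ℤ.pos-* y n) ⟩
  + gcd m n ℤ.+ + y ℤ.* + n ℤ.+ (ℤ.- + y) ℤ.* + n ≡⟨ lemma (+ gcd m n) (+ y) (+ n) ⟩
  + gcd m n ∎)
  where
  open ≡-Reasoning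
  lemma : ∀ g y n → g ℤ.+ y ℤ.* n ℤ.+ (ℤ.- y) ℤ.* n ≡ g
  lemma = ℤ-solve-∀
... | Bézout.-+ x y eq = ℤ.- + x , + y , (begin
  (ℤ.- + x) ℤ.* + m ℤ.+ + y ℤ.* + n          ≡⟨ cong (λ z → (ℤ.- + x) ℤ.* + m ℤ.+ z) (ℤ.pos-* y n) ⟨
  (ℤ.- + x) ℤ.* + m ℤ.+ + (y * n)            ≡⟨ cong (λ k → (ℤ.- + x) ℤ.* + m ℤ.+ + k) eq ⟨
  (ℤ.- + x) ℤ.* + m ℤ.+ (+ gcd m n ℤ.+ + (x * m))
    ≡⟨ cong (λ z → (ℤ.- + x) ℤ.* + m ℤ.+ (+ gcd m n ℤ.+ z)) (ℤ.pos-* x m) ⟩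
  (ℤ.- + x) ℤ.* + m ℤ.+ (+ gcd m n ℤ.+ + x ℤ.* + m) ≡⟨ lemma (+ gcd m n) (+ x) (+ m) ⟩
  + gcd m n ∎)
  where
  open ≡-Reasoning
  lemma : ∀ g x m → (ℤ.- x) ℤ.* m ℤ.+ (g ℤ.+ x ℤ.* m) ≡ g
  lemma = ℤ-solve-∀

bézout-mod : ∀ c d N → gcd (gcd c d) N ≡ 1 → ∃₂ λ u v → u ℤ.* + c ℤ.+ v ℤ.* + d ≈[ N ] 1ℤ
bézout-mod c d N g≡1 with u , v , eq ← bézout c d | u′ , v′ , eq′ ← bézout (gcd c d) N =
  u′ ℤ.* u , u′ ℤ.* v , congruent (ℤ.- v′) (begin
    u′ ℤ.* u ℤ.* + c ℤ.+ u′ ℤ.* v ℤ.* + d                     ≡⟨ lemma u′ u v v′ (+ c) (+ d) (+ N) ⟩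
    u′ ℤ.* (u ℤ.* + c ℤ.+ v ℤ.* + d) ℤ.+ v′ ℤ.* + N ℤ.+ (ℤ.- v′) ℤ.* + N
      ≡⟨ cong (λ z → u′ ℤ.* z ℤ.+ v′ ℤ.* + N ℤ.+ (ℤ.- v′) ℤ.* + N) eq ⟩
    u′ ℤ.* + gcd c d ℤ.+ v′ ℤ.* + N ℤ.+ (ℤ.- v′) ℤ.* + N
      ≡⟨ cong (λ z → z ℤ.+ (ℤ.- v′) ℤ.* + N) (trans eq′ (cong +_ g≡1)) ⟩
    1ℤ ℤ.+ (ℤ.- v′) ℤ.* + N ∎)
  where
  open ≡-Reasoning
  lemma : ∀ u′ u v v′ c d N → u′ ℤ.* u ℤ.* c ℤ.+ u′ ℤ.* v ℤ.* d ≡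
          u′ ℤ.* (u ℤ.* c ℤ.+ v ℤ.* d) ℤ.+ v′ ℤ.* N ℤ.+ (ℤ.- v′) ℤ.* N
  lemma = ℤ-solve-∀

%⇒≈ : ∀ m n .{{_ : NonZero n}} {k} → m % n ≡ k → + m ≈[ n ] + k
%⇒≈ m n refl = congruent (+ (m / n))
  (trans (cong +_ (m≡m%n+[m/n]*n m n)) (cong (ℤ._+_ (+ (m % n))) (ℤ.pos-* (m / n) n)))

even-or-odd : ∀ m → m % 2 ≡ 0 ⊎ m % 2 ≡ 1
even-or-odd m with m % 2 | m%n<n m 2
... | 0 | _ = inj₁ refl
... | 1 | _ = inj₂ refl
... | suc (suc _) | s≤s (s≤s ())

odd⇒≡ : ∀ m → m % 2 ≡ 1 → m ≡ 1 + m / 2 * 2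
odd⇒≡ m eq = trans (m≡m%n+[m/n]*n m 2) (cong (_+ m / 2 * 2) eq)

-- The nonzero vectors (X P , Y P) of 𝔽₂².
Point : Set
Point = Fin 3

X Y X* Y* : Point → ℕ
X 0F = 1
X 1F = 0
X 2F = 1
Y 0F = 0
Y 1F = 1
Y 2F = 1
X* = Y
Y* = X

-- (X* P , Y* P) spans the orthogonal complement of P.
orthogonal⇒≡ : ∀ Q P → 2 ∣ X* Q * X P + Y* Q * Y P → P ≡ Q
orthogonal⇒≡ = from-yes (all? λ Q → all? λ P → (2 ∣? X* Q * X P + Y* Q * Y P) →-dec (P ≟ Q))

Exhaustive : (P₀ P₁ P₂ : Point) → Set
Exhaustive P₀ P₁ P₂ = ∀ Q → P₀ ≡ Q ⊎ P₁ ≡ Q ⊎ P₂ ≡ Q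

exhaustive⇒basis : ∀ P₀ P₁ P₂ → Exhaustive P₀ P₁ P₂ →
                   (X P₀ + X P₁ + X P₂) % 2 ≡ 0 × (Y P₀ + Y P₁ + Y P₂) % 2 ≡ 0 ×
                   (X P₁ * Y P₂ + Y P₁ * X P₂) % 2 ≡ 1
exhaustive⇒basis = from-yes (all? λ P₀ → all? λ P₁ → all? λ P₂ →
  (all? λ Q → (P₀ ≟ Q) ⊎-dec ((P₁ ≟ Q) ⊎-dec (P₂ ≟ Q))) →-dec
  (((X P₀ + X P₁ + X P₂) % 2 ℕ.≟ 0) ×-dec (((Y P₀ + Y P₁ + Y P₂) % 2 ℕ.≟ 0) ×-dec
   ((X P₁ * Y P₂ + Y P₁ * X P₂) % 2 ℕ.≟ 1))))

parities : ∀ c d → (2 ∣ c × 2 ∣ d) ⊎ (∃[ Q ] c % 2 ≡ X Q × d % 2 ≡ Y Q)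
parities c d with even-or-odd c | even-or-odd d
... | inj₁ c≡0 | inj₁ d≡0 = inj₁ (m%n≡0⇒n∣m c 2 c≡0 , m%n≡0⇒n∣m d 2 d≡0)
... | inj₁ c≡0 | inj₂ d≡1 = inj₂ (1F , c≡0 , d≡1)
... | inj₂ c≡1 | inj₁ d≡0 = inj₂ (0F , c≡1 , d≡0)
... | inj₂ c≡1 | inj₂ d≡1 = inj₂ (2F , c≡1 , d≡1)

half : ∀ {x} h → .{{_ : NonZero h}} → x < h * 2 → h * 2 ∣ 2 * x → x ≡ 0 ⊎ x ≡ h
half {x} h x<2h 2h∣2x with *-cancelʳ-∣ {h} {x} 2 (subst (h * 2 ∣_) (ℕ.*-comm 2 x) 2h∣2x)
... | divides 0 eq = inj₁ eq
... | divides 1 eq = inj₂ (trans eq (ℕ.*-identityˡ h))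
... | divides (suc (suc k)) eq = contradiction
  (subst₂ _≤_ (ℕ.*-comm 2 h) (sym eq) (ℕ.*-monoˡ-≤ h (s≤s (s≤s (z≤n {k}))))) (ℕ.<⇒≱ x<2h)

half⇒even : ∀ {x} → x ≢ 0 → x < N → N ∣ 2 * x → N ≡ x * 2
half⇒even x≢0 x<N (divides 0 eq) = contradiction (ℕ.m+n≡0⇒m≡0 _ eq) x≢0
half⇒even {N} {x} x≢0 x<N (divides 1 eq) = trans (sym (ℕ.*-identityˡ N)) (trans (sym eq) (ℕ.*-comm 2 x))
half⇒even {N} {x} x≢0 x<N (divides (suc (suc k)) eq) = contradiction
  (subst₂ _≤_ refl (sym eq) (ℕ.*-monoˡ-≤ N (s≤s (s≤s (z≤n {k}))))) (ℕ.<⇒≱ (ℕ.*-monoʳ-< 2 x<N))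

thinMatrix-spanned : ∀ N h .{{_ : NonZero N}} → N ≡ h * 2 → ∀ w →
                     w ∈ rowSpan (thinMatrix N) ⇔ Spanned (thinRow₁ h) (thinRow₂ h) (entry w) N
thinMatrix-spanned N h N≡ w = mk⇔
  (λ w∈ → spanned-cong row₁ row₂ (rowSpan⇒spanned _ _ w∈))
  (λ w∈ → spanned⇒rowSpan _ _ (spanned-cong (λ i → ≈-sym (row₁ i)) (λ i → ≈-sym (row₂ i)) w∈))
  where
  N/2 : + toℕ ((N / 2) mod N) ≈[ N ] + h
  N/2 = ≈-trans (mod-≈ (N / 2)) (≈-reflexive (cong +_ (trans (cong (_/ 2) N≡) (m*n/n≡m h 2))))

  N-1 : + toℕ ((N ∸ 1) mod N) ≈[ N ] -1ℤ
  N-1 = ≈-trans (mod-≈ (N ∸ 1)) (congruent 1ℤ (trans (lemma (+ (N ∸ 1)))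
    (cong (λ k → -1ℤ ℤ.+ 1ℤ ℤ.* + k) (ℕ.m+[n∸m]≡n (>-nonZero⁻¹ N)))))
    where
    lemma : ∀ x → x ≡ -1ℤ ℤ.+ 1ℤ ℤ.* (1ℤ ℤ.+ x)
    lemma = ℤ-solve-∀

  row₁ : ∀ i → entry (lookup (thinMatrix N) 0F) i ≈[ N ] thinRow₁ h i
  row₁ 0F = N/2
  row₁ 1F = N/2
  row₁ 2F = mod-≈ 0
  row₁ 3F = mod-≈ 0
  row₁ 4F = mod-≈ 0

  row₂ : ∀ i → entry (lookup (thinMatrix N) 1F) i ≈[ N ] thinRow₂ h i
  row₂ 0F = N/2
  row₂ 1F = mod-≈ 0
  row₂ 2F = N/2
  row₂ 3F = mod-≈ 1
  row₂ 4F = N-1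

-- One of σ, τ, σ + τ is even.
thin-zero : ∀ h {w} → Spanned (thinRow₁ h) (thinRow₂ h) w (h * 2) → ∃[ i ] w i ≈[ h * 2 ] 0ℤ
thin-zero h {w} (s , t , eq) = find (residue s) (residue t) (residue-≈ s) (residue-≈ t)
  where
  double : ∀ {z y x} i → w i ≈[ h * 2 ] x → x ≡ + h ℤ.* z → z ≈[ 2 ] y → + h ℤ.* y ≡ 0ℤ → w i ≈[ h * 2 ] 0ℤ
  double i w≈ eq₁ z≈ eq₂ = ≈-trans w≈ (≈-trans (≈-reflexive eq₁)
    (≈-trans (*-scale-≈ h z≈) (≈-reflexive eq₂)))

  find : (a b : Fin 2) → + toℕ a ≈[ 2 ] s → + toℕ b ≈[ 2 ] t → ∃[ i ] w i ≈[ h * 2 ] 0ℤ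
  find 0F _  s≈ t≈ = 1F , double 1F (eq 1F) (lemma s t (+ h)) (≈-sym s≈) (ℤ.*-zeroʳ (+ h))
    where
    lemma : ∀ s t h → s ℤ.* h ℤ.+ t ℤ.* 0ℤ ≡ h ℤ.* s
    lemma = ℤ-solve-∀
  find 1F 0F s≈ t≈ = 2F , double 2F (eq 2F) (lemma s t (+ h)) (≈-sym t≈) (ℤ.*-zeroʳ (+ h))
    where
    lemma : ∀ s t h → s ℤ.* 0ℤ ℤ.+ t ℤ.* h ≡ h ℤ.* t
    lemma = ℤ-solve-∀
  find 1F 1F s≈ t≈ = 0F , double 0F (eq 0F) (lemma s t (+ h))
    (≈-trans (≈-sym (+-cong-≈ s≈ t≈)) (congruent 1ℤ refl)) (ℤ.*-zeroʳ (+ h))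
    where
    lemma : ∀ s t h → s ℤ.* h ℤ.+ t ℤ.* h ≡ h ℤ.* (s ℤ.+ t)
    lemma = ℤ-solve-∀

≅thin⇒Thin : ∀ .{{_ : NonZero N}} {C : Code N 5} → 2 ∣ N → C ≅ rowSpan (thinMatrix N) → Thin C
≅thin⇒Thin {N} {C} (divides h N≡) (π , C≅) (w , w∈ , w≢0)
  with i , w≈0 ← thin-zero h {entry (permute π w)} (subst (Spanned _ _ _) N≡
    (Equivalence.to (thinMatrix-spanned N h N≡ (permute π w)) (Equivalence.to (C≅ w) w∈))) =
  w≢0 (π ⟨$⟩ˡ i) (trans (sym (lookup∘tabulate (λ i → lookup w (π ⟨$⟩ˡ i)) i))
    (toℕ-≈-injective _ _ (≈-trans (subst (entry (permute π w) i ≈[_] 0ℤ) (sym N≡) w≈0) (≈-sym (mod-≈ 0)))))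

-- Thin codes

Σ[_] : ∀ {n} → (Fin n → ℕ) → ℕ
Σ[ f ] = Table.foldr _+_ 0 f

sum-map-toℕ : ∀ {n N} (w : Word N n) → sum (map toℕ w) ≡ Σ[ (λ i → toℕ (lookup w i)) ]
sum-map-toℕ []      = refl
sum-map-toℕ (x ∷ w) = cong (λ s → toℕ x + s) (sum-map-toℕ w)

Σ-permute : ∀ {n} (f : Fin n → ℕ) (π : Permutation′ n) → Σ[ f ] ≡ Σ[ (λ i → f (π ⟨$⟩ˡ i)) ]
Σ-permute f π = sum-permute ℕ.+-0-commutativeMonoid f (flip π)

∀-permuted : ∀ {n} {P : Fin n → Set} (π : Permutation′ n) → (∀ i → P (π ⟨$⟩ˡ i)) → ∀ i → P i
∀-permuted {P = P} π p i = subst P (inverseˡ π) (p (π ⟨$⟩ʳ i))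

pos-product : ∀ {m} k l → m ≡ k * l → + m ≡ + k ℤ.* + l
pos-product k l refl = ℤ.pos-* k l

module GeneratedCode (N : ℕ) .{{_ : NonZero N}} (N≥9 : N ≥ 9) (C : Code N 5)
  (extended : Extended C) (isGCD : IsGCD (λ k → k ≡ N ⊎ k ∈ Entry C) 1)
  (r r′ : Word N 5) (generated : IsGeneratedBy C (r ∷ r′ ∷ [])) where

  open Forms N

  a b : Fin 5 → ℕ
  a i = toℕ (lookup r i)
  b i = toℕ (lookup r′ i)

  ∈C⇔spanned : ∀ w → w ∈ C ⇔ Spanned (entry r) (entry r′) (entry w) N
  ∈C⇔spanned w = mk⇔ (λ w∈ → rowSpan⇒spanned r r′ (proj₁ generated w∈))
                     (λ w∈ → proj₂ generated (spanned⇒rowSpan r r′ w∈))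

  common-divisor : ∀ d → d ∣ N → (∀ i → d ∣ a i) → (∀ i → d ∣ b i) → d ∣ 1
  common-divisor d d∣N d∣a d∣b = IsGCD.greatest isGCD λ where
    (inj₁ refl) → d∣N
    (inj₂ (w , w∈ , i , refl)) → let s , t , eq = Equivalence.to (∈C⇔spanned w) w∈ in
      ≈⇒∣ d d∣N (ℤ.∣m∣n⇒∣m+n (ℤ.∣n⇒∣m*n s (ℤ.∣ᵤ⇒∣ (d∣a i))) (ℤ.∣n⇒∣m*n t (ℤ.∣ᵤ⇒∣ (d∣b i)))) (eq i)

  annihilator : ∀ e → (∀ i → N ∣ e * a i) → (∀ i → N ∣ e * b i) → N ∣ e
  annihilator e N∣ea N∣eb = subst (N ∣_) (trans (cong (e *_) g≡1) (ℕ.*-identityʳ e))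
    (∣*gcd e N _ (n∣m*n e) (∣*gcd e (gcds a) (gcds b) (∣*gcds e a N∣ea) (∣*gcds e b N∣eb)))
    where
    g≡1 : gcd N (gcd (gcds a) (gcds b)) ≡ 1
    g≡1 = ∣1⇒≡1 (common-divisor _ (gcd[m,n]∣m N _)
      (λ i → ∣-trans (gcd[m,n]∣n N _) (∣-trans (gcd[m,n]∣m (gcds a) _) (gcds∣ a i)))
      (λ i → ∣-trans (gcd[m,n]∣n N _) (∣-trans (gcd[m,n]∣n (gcds a) _) (gcds∣ b i))))

  ∣Σ-permuted : ∀ (w : Word N 5) → w ∈ C → (π : Permutation′ 5) → N ∣ Σ[ (λ i → toℕ (lookup w (π ⟨$⟩ˡ i))) ]
  ∣Σ-permuted w w∈ π = subst (N ∣_) (trans (sum-map-toℕ w) (Σ-permute (λ i → toℕ (lookup w i)) π)) (extended w∈)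

  r∈C : r ∈ C
  r∈C = Equivalence.from (∈C⇔spanned r) (1ℤ , 0ℤ , λ i → ≈-reflexive (lemma (entry r i) (entry r′ i)))
    where
    lemma : ∀ x y → x ≡ 1ℤ ℤ.* x ℤ.+ 0ℤ ℤ.* y
    lemma = ℤ-solve-∀

  r′∈C : r′ ∈ C
  r′∈C = Equivalence.from (∈C⇔spanned r′) (0ℤ , 1ℤ , λ i → ≈-reflexive (lemma (entry r i) (entry r′ i)))
    where
    lemma : ∀ x y → y ≡ 0ℤ ℤ.* x ℤ.+ 1ℤ ℤ.* y
    lemma = ℤ-solve-∀

  thin⇒covering : Thin C → CoveringBelow a b 5 Perm.id
  thin⇒covering thin s t with any? (λ i → N ∣? value a b s t i)
  ... | yes (i , v∣) = i , toℕ<n i , v∣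
  ... | no ¬∣ = contradiction (w , w∈ , λ i w≡0 → ¬∣ (i , ∣-of i w≡0)) thin
    where
    w : Word N 5
    w = tabulate (λ i → value a b s t i mod N)

    w≈ : ∀ i → entry w i ≈[ N ] + value a b s t i
    w≈ i rewrite lookup∘tabulate (λ i → value a b s t i mod N) i = mod-≈ (value a b s t i)

    w∈ : w ∈ C
    w∈ = Equivalence.from (∈C⇔spanned w) (+ s , + t , λ i → ≈-trans (w≈ i) (≈-reflexive
      (cong₂ ℤ._+_ (ℤ.pos-* s (a i)) (ℤ.pos-* t (b i)))))

    ∣-of : ∀ i → lookup w i ≡ 0# → N ∣ value a b s t i
    ∣-of i w≡0 = ≈⇒∣ N ∣-refl (ℤ.∣ᵤ⇒∣ (N ∣0)) (≈-trans (≈-sym (w≈ i))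
      (subst (λ x → + toℕ x ≈[ N ] 0ℤ) (sym w≡0) (mod-≈ 0)))

  zero-column : ∀ i → N ∣ a i → N ∣ b i → Degenerate C
  zero-column i N∣a N∣b = i , λ {w} w∈ → let s , t , eq = Equivalence.to (∈C⇔spanned w) w∈ in
    toℕ-≈-injective _ _ (≈-trans (≈-trans (eq i)
      (≈-trans (+-cong-≈ (*-congˡ-≈ s (∣⇒≈0 N∣a)) (*-congˡ-≈ t (∣⇒≈0 N∣b)))
        (≈-reflexive (cong₂ ℤ._+_ (ℤ.*-zeroʳ s) (ℤ.*-zeroʳ t))))) (≈-sym (mod-≈ 0)))

  Kills : ℕ → ℕ → Permutation′ 5 → Set
  Kills n e π = ∀ i → toℕ i < n → N ∣ e * a (π ⟨$⟩ˡ i) × N ∣ e * b (π ⟨$⟩ˡ i)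

  value₁₀ : ∀ i → value a b 1 0 i ≡ a i
  value₁₀ i = trans (ℕ.+-identityʳ (1 * a i)) (ℕ.*-identityˡ (a i))

  value₀₁ : ∀ i → value a b 0 1 i ≡ b i
  value₀₁ i = ℕ.*-identityˡ (b i)

  value₁₁ : ∀ i → value a b 1 1 i ≡ a i + b i
  value₁₁ i = cong₂ _+_ (ℕ.*-identityˡ (a i)) (ℕ.*-identityˡ (b i))

  ∣e*-tail : ∀ e x {y} → N ∣ e * (x + y) → N ∣ e * x → N ∣ e * y
  ∣e*-tail e x {y} p q = ∣m+n∣m⇒∣n (subst (N ∣_) (ℕ.*-distribˡ-+ e x y) p) q

  -- Among (1,0), (0,1), (1,1) two have the same exponent, and these two generate ℤ².
  uniform-exponent : ∀ {n e e′ π} → (∀ s t → ∃[ k ] k List.∈ (e ∷ e′ ∷ []) ×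
                       (∀ i → toℕ i < n → N ∣ k * value a b s t (π ⟨$⟩ˡ i))) →
                     Kills n e π ⊎ Kills n e′ π
  uniform-exponent {n} {e} {e′} {π} exponent with exponent 1 0 | exponent 0 1 | exponent 1 1
  ... | k₁ , k₁∈ , kills₁ | k₂ , k₂∈ , kills₂ | k₃ , k₃∈ , kills₃ = choose k₁∈ k₂∈ k₃∈
    where
    A : ∀ i → toℕ i < n → N ∣ k₁ * a (π ⟨$⟩ˡ i)
    A i i<n = subst (λ x → N ∣ k₁ * x) (value₁₀ (π ⟨$⟩ˡ i)) (kills₁ i i<n)

    B : ∀ i → toℕ i < n → N ∣ k₂ * b (π ⟨$⟩ˡ i)
    B i i<n = subst (λ x → N ∣ k₂ * x) (value₀₁ (π ⟨$⟩ˡ i)) (kills₂ i i<n)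

    A+B : ∀ i → toℕ i < n → N ∣ k₃ * (a (π ⟨$⟩ˡ i) + b (π ⟨$⟩ˡ i))
    A+B i i<n = subst (λ x → N ∣ k₃ * x) (value₁₁ (π ⟨$⟩ˡ i)) (kills₃ i i<n)

    B+A : ∀ i → toℕ i < n → N ∣ k₃ * (b (π ⟨$⟩ˡ i) + a (π ⟨$⟩ˡ i))
    B+A i i<n = subst (λ x → N ∣ k₃ * x) (ℕ.+-comm (a (π ⟨$⟩ˡ i)) _) (A+B i i<n)

    k₁≡k₂ : k₁ ≡ k₂ → Kills n k₁ π
    k₁≡k₂ refl i i<n = A i i<n , B i i<n

    k₁≡k₃ : k₁ ≡ k₃ → Kills n k₁ π
    k₁≡k₃ refl i i<n = A i i<n , ∣e*-tail k₁ (a (π ⟨$⟩ˡ i)) (A+B i i<n) (A i i<n)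

    k₂≡k₃ : k₂ ≡ k₃ → Kills n k₂ π
    k₂≡k₃ refl i i<n = ∣e*-tail k₂ (b (π ⟨$⟩ˡ i)) (B+A i i<n) (B i i<n) , B i i<n

    choose : k₁ List.∈ (e ∷ e′ ∷ []) → k₂ List.∈ (e ∷ e′ ∷ []) → k₃ List.∈ (e ∷ e′ ∷ []) →
             Kills n e π ⊎ Kills n e′ π
    choose (here refl)         (here refl)         _                   = inj₁ (k₁≡k₂ refl)
    choose (here refl)         (there (here refl)) (here refl)         = inj₁ (k₁≡k₃ refl)
    choose (here refl)         (there (here refl)) (there (here refl)) = inj₂ (k₂≡k₃ refl)
    choose (there (here refl)) (there (here refl)) _                   = inj₂ (k₁≡k₂ refl)
    choose (there (here refl)) (here refl)         (here refl)         = inj₁ (k₂≡k₃ refl)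
    choose (there (here refl)) (here refl)         (there (here refl)) = inj₂ (k₁≡k₃ refl)

  -- The last column is determined by the others, the rows having zero sum.
  kills-all : ∀ {e π} → Kills 4 e π → ∀ i → N ∣ e * a (π ⟨$⟩ˡ i) × N ∣ e * b (π ⟨$⟩ˡ i)
  kills-all {e} {π} kills i with toℕ i ℕ.<? 4
  ... | yes i<4 = kills i i<4
  kills-all {e} {π} kills 0F | no i≮4 = contradiction (s≤s z≤n) i≮4
  kills-all {e} {π} kills 1F | no i≮4 = contradiction (s≤s (s≤s z≤n)) i≮4
  kills-all {e} {π} kills 2F | no i≮4 = contradiction (s≤s (s≤s (s≤s z≤n))) i≮4
  kills-all {e} {π} kills 3F | no i≮4 = contradiction ℕ.≤-refl i≮4
  kills-all {e} {π} kills 4F | no _ =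
    last r r∈C (λ i i<4 → proj₁ (kills i i<4)) , last r′ r′∈C (λ i i<4 → proj₂ (kills i i<4))
    where
    last : ∀ w → w ∈ C → (∀ i → toℕ i < 4 → N ∣ e * toℕ (lookup w (π ⟨$⟩ˡ i))) →
           N ∣ e * toℕ (lookup w (π ⟨$⟩ˡ 4F))
    last w w∈ k = subst (λ x → N ∣ e * x) (ℕ.+-identityʳ (f 4F))
      (∣e*-tail e (f 3F) (∣e*-tail e (f 2F) (∣e*-tail e (f 1F) (∣e*-tail e (f 0F)
        (∣n⇒∣m*n e (∣Σ-permuted w w∈ π)) (k 0F (s≤s z≤n))) (k 1F (s≤s (s≤s z≤n))))
        (k 2F (s≤s (s≤s (s≤s z≤n))))) (k 3F ℕ.≤-refl))
      where
      f : Fin 5 → ℕ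
      f i = toℕ (lookup w (π ⟨$⟩ˡ i))

  exponent-bound : ∀ e .{{_ : NonZero e}} {π} → Kills 4 e π → e ≤ 8 → ⊥
  exponent-bound e {π} kills e≤8 = ℕ.<⇒≱ N≥9 (ℕ.≤-trans (∣⇒≤ (annihilator e
    (∀-permuted π (λ i → proj₁ (kills-all {e} {π} kills i)))
    (∀-permuted π (λ i → proj₂ (kills-all {e} {π} kills i))))) e≤8)

  six-or-eight : ∀ {n π} → 4 ≤ n → (∀ s t → ∃[ k ] k List.∈ (6 ∷ 8 ∷ []) ×
                       (∀ i → toℕ i < n → N ∣ k * value a b s t (π ⟨$⟩ˡ i))) → ⊥
  six-or-eight {n} {π} 4≤n exponent with uniform-exponent {n} {6} {8} {π} exponent
  ... | inj₁ kills = exponent-bound 6 {π} (λ i i<4 → kills i (ℕ.≤-trans i<4 4≤n)) (ℕ.m≤n+m 6 2)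
  ... | inj₂ kills = exponent-bound 8 {π} (λ i i<4 → kills i (ℕ.≤-trans i<4 4≤n)) ℕ.≤-refl

  exponent⇒kills : ∀ {n e π} → (∀ s t → ∃[ k ] k List.∈ (e ∷ []) ×
                       (∀ i → toℕ i < n → N ∣ k * value a b s t (π ⟨$⟩ˡ i))) → Kills n e π
  exponent⇒kills {e = e} {π} exponent i i<n with exponent 1 0 | exponent 0 1
  ... | _ , here refl , kills₁ | _ , here refl , kills₂ =
    subst (λ x → N ∣ e * x) (value₁₀ (π ⟨$⟩ˡ i)) (kills₁ i i<n) ,
    subst (λ x → N ∣ e * x) (value₀₁ (π ⟨$⟩ˡ i)) (kills₂ i i<n)

  kills₁⇒degenerate : ∀ {n π} → Kills (suc n) 1 π → Degenerate C
  kills₁⇒degenerate {π = π} kills with N∣a , N∣b ← kills 0F (s≤s z≤n) =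
    zero-column (π ⟨$⟩ˡ 0F) (subst (N ∣_) (ℕ.*-identityˡ (a (π ⟨$⟩ˡ 0F))) N∣a)
      (subst (N ∣_) (ℕ.*-identityˡ (b (π ⟨$⟩ˡ 0F))) N∣b)

  three-columns : ¬ Degenerate C → Thin C → ∃[ π ] CoveringBelow a b 3 π × Kills 3 2 π
  three-columns ¬deg thin =
    by-size (irredundant-subcovering a b 5 Perm.id ℕ.≤-refl (thin⇒covering thin))
    where
    by-size : (∃₂ λ n π → n ≤ 5 × Irredundant a b n π) → ∃[ π ] CoveringBelow a b 3 π × Kills 3 2 π
    by-size (0 , π , _ , cov , _) with () ← proj₁ (proj₂ (cov 0 0))
    by-size (1 , π , n≤5 , irr) = contradiction
      (kills₁⇒degenerate {π = π} (exponent⇒kills {π = π}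
        (irredundant-exponent a b (1 ∷ []) window certificate₁ n≤5 {π} irr))) ¬deg
    by-size (2 , π , n≤5 , irr) = contradiction
      (kills₁⇒degenerate {π = π} (exponent⇒kills {π = π}
        (irredundant-exponent a b (1 ∷ []) window certificate₂ n≤5 {π} irr))) ¬deg
    by-size (3 , π , n≤5 , irr@(cov , _)) =
      π , cov , exponent⇒kills {π = π} (irredundant-exponent a b (2 ∷ []) window certificate₃ n≤5 {π} irr)
    by-size (4 , π , n≤5 , irr) =
      ⊥-elim (six-or-eight {π = π} ℕ.≤-refl (irredundant-exponent a b (6 ∷ 8 ∷ []) window certificate₄ n≤5 {π} irr))
    by-size (5 , π , n≤5 , irr) =
      ⊥-elim (six-or-eight {π = π} (ℕ.n≤1+n 4) (irredundant-exponent a b (6 ∷ 8 ∷ []) window certificate₅ n≤5 {π} irr))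
    by-size (suc (suc (suc (suc (suc (suc _))))) , _ , s≤s (s≤s (s≤s (s≤s (s≤s ())))) , _)

  N≢0 : N ≢ 0
  N≢0 N≡0 = ℕ.n≮0 (subst (9 ≤_) N≡0 N≥9)

  even-order : ∀ {π} → ¬ Degenerate C → Kills 3 2 π → ∃[ h ] N ≡ h * 2
  even-order {π} ¬deg kills with 2a , 2b ← kills 0F (s≤s z≤n)
    with a (π ⟨$⟩ˡ 0F) ℕ.≟ 0 | b (π ⟨$⟩ˡ 0F) ℕ.≟ 0
  ... | no a≢0 | _ = a (π ⟨$⟩ˡ 0F) , half⇒even a≢0 (toℕ<n (lookup r (π ⟨$⟩ˡ 0F))) 2a
  ... | yes _ | no b≢0 = b (π ⟨$⟩ˡ 0F) , half⇒even b≢0 (toℕ<n (lookup r′ (π ⟨$⟩ˡ 0F))) 2b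
  ... | yes a≡0 | yes b≡0 = contradiction
    (zero-column (π ⟨$⟩ˡ 0F) (subst (N ∣_) (sym a≡0) (N ∣0)) (subst (N ∣_) (sym b≡0) (N ∣0))) ¬deg

  module _ (h : ℕ) (N≡ : N ≡ h * 2) where

    instance
      h≢0 : NonZero h
      h≢0 = ≢-nonZero λ h≡0 → N≢0 (trans N≡ (cong (_* 2) h≡0))

    2∣N : 2 ∣ N
    2∣N = divides h N≡

    HasPoint : Permutation′ 5 → Fin 5 → Point → Set
    HasPoint π i P = a (π ⟨$⟩ˡ i) ≡ h * X P × b (π ⟨$⟩ˡ i) ≡ h * Y P

    hasPoint : ∀ π i → ¬ Degenerate C → N ∣ 2 * a (π ⟨$⟩ˡ i) → N ∣ 2 * b (π ⟨$⟩ˡ i) →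
               ∃[ P ] HasPoint π i P
    hasPoint π i ¬deg 2a 2b
      with half h (subst (a (π ⟨$⟩ˡ i) <_) N≡ (toℕ<n (lookup r (π ⟨$⟩ˡ i)))) (subst (_∣ 2 * a (π ⟨$⟩ˡ i)) N≡ 2a)
         | half h (subst (b (π ⟨$⟩ˡ i) <_) N≡ (toℕ<n (lookup r′ (π ⟨$⟩ˡ i)))) (subst (_∣ 2 * b (π ⟨$⟩ˡ i)) N≡ 2b)
    ... | inj₁ a≡0 | inj₁ b≡0 = contradiction
      (zero-column (π ⟨$⟩ˡ i) (subst (N ∣_) (sym a≡0) (N ∣0)) (subst (N ∣_) (sym b≡0) (N ∣0))) ¬deg
    ... | inj₂ a≡h | inj₁ b≡0 = 0F , trans a≡h (sym (ℕ.*-identityʳ h)) , trans b≡0 (sym (ℕ.*-zeroʳ h))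
    ... | inj₁ a≡0 | inj₂ b≡h = 1F , trans a≡0 (sym (ℕ.*-zeroʳ h)) , trans b≡h (sym (ℕ.*-identityʳ h))
    ... | inj₂ a≡h | inj₂ b≡h = 2F , trans a≡h (sym (ℕ.*-identityʳ h)) , trans b≡h (sym (ℕ.*-identityʳ h))

    vanishing-point : ∀ {π i P} Q → HasPoint π i P → N ∣ value a b (X* Q) (Y* Q) (π ⟨$⟩ˡ i) → P ≡ Q
    vanishing-point {P = P} Q (a≡ , b≡) v∣ = orthogonal⇒≡ Q P (*-cancelˡ-∣ h
      (subst₂ _∣_ N≡ (trans (cong₂ (λ x y → X* Q * x + Y* Q * y) a≡ b≡) (lemma (X* Q) (Y* Q) h (X P) (Y P))) v∣))
      where
      lemma : ∀ s t h x y → s * (h * x) + t * (h * y) ≡ h * (s * x + t * y)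
      lemma = solve-∀

    record Normalised (π : Permutation′ 5) (P₀ P₁ P₂ : Point) : Set where
      constructor normalised
      field
        column₀    : HasPoint π 0F P₀
        column₁    : HasPoint π 1F P₁
        column₂    : HasPoint π 2F P₂
        exhaustive : Exhaustive P₀ P₁ P₂

    normalise : ∀ {π} → ¬ Degenerate C → CoveringBelow a b 3 π → Kills 3 2 π →
                ∃[ P₀ ] ∃[ P₁ ] ∃[ P₂ ] Normalised π P₀ P₁ P₂
    normalise {π} ¬deg cov kills
      with P₀ , p₀ ← (let 2a , 2b = kills 0F (s≤s z≤n) in hasPoint π 0F ¬deg 2a 2b)
      with P₁ , p₁ ← (let 2a , 2b = kills 1F (s≤s (s≤s z≤n)) in hasPoint π 1F ¬deg 2a 2b)
      with P₂ , p₂ ← (let 2a , 2b = kills 2F (s≤s (s≤s (s≤s z≤n))) in hasPoint π 2F ¬deg 2a 2b) =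
      P₀ , P₁ , P₂ , normalised p₀ p₁ p₂ exhaustive
      where
      exhaustive : Exhaustive P₀ P₁ P₂
      exhaustive Q = find (cov (X* Q) (Y* Q))
        where
        find : (∃[ i ] toℕ i < 3 × N ∣ value a b (X* Q) (Y* Q) (π ⟨$⟩ˡ i)) → P₀ ≡ Q ⊎ P₁ ≡ Q ⊎ P₂ ≡ Q
        find (0F , _ , v∣) = inj₁ (vanishing-point {π} {0F} Q p₀ v∣)
        find (1F , _ , v∣) = inj₂ (inj₁ (vanishing-point {π} {1F} Q p₁ v∣))
        find (2F , _ , v∣) = inj₂ (inj₂ (vanishing-point {π} {2F} Q p₂ v∣))
        find (3F , s≤s (s≤s (s≤s ())) , _)
        find (4F , s≤s (s≤s (s≤s ())) , _)

    last-columns : ∀ w → w ∈ C → ∀ π x₀ x₁ x₂ → toℕ (lookup w (π ⟨$⟩ˡ 0F)) ≡ h * x₀ →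
                   toℕ (lookup w (π ⟨$⟩ˡ 1F)) ≡ h * x₁ → toℕ (lookup w (π ⟨$⟩ˡ 2F)) ≡ h * x₂ →
                   (x₀ + x₁ + x₂) % 2 ≡ 0 →
                   N ∣ toℕ (lookup w (π ⟨$⟩ˡ 3F)) + toℕ (lookup w (π ⟨$⟩ˡ 4F))
    last-columns w w∈ π x₀ x₁ x₂ e₀ e₁ e₂ even = ∣m+n∣m⇒∣n
      (subst (N ∣_) (trans (cong₂ _+_ e₀ (cong₂ _+_ e₁ (cong (_+ (f 3F + (f 4F + 0))) e₂)))
        (lemma h x₀ x₁ x₂ (f 3F) (f 4F))) (∣Σ-permuted w w∈ π))
      (subst (_∣ h * (x₀ + x₁ + x₂)) (sym N≡) (*-monoʳ-∣ h (m%n≡0⇒n∣m _ 2 even)))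
      where
      f : Fin 5 → ℕ
      f i = toℕ (lookup w (π ⟨$⟩ˡ i))

      lemma : ∀ h x y z u v → h * x + (h * y + (h * z + (u + (v + 0)))) ≡ h * (x + y + z) + (u + v)
      lemma = solve-∀

    module _ {π P₀ P₁ P₂} (norm : Normalised π P₀ P₁ P₂) where
      open Normalised norm

      c d c′ d′ : ℕ
      c  = a (π ⟨$⟩ˡ 3F)
      d  = b (π ⟨$⟩ˡ 3F)
      c′ = a (π ⟨$⟩ˡ 4F)
      d′ = b (π ⟨$⟩ˡ 4F)

      N∣c+c′ : N ∣ c + c′
      N∣c+c′ = last-columns r r∈C π _ _ _ (proj₁ column₀) (proj₁ column₁) (proj₁ column₂)
        (proj₁ (exhaustive⇒basis P₀ P₁ P₂ exhaustive))

      N∣d+d′ : N ∣ d + d′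
      N∣d+d′ = last-columns r′ r′∈C π _ _ _ (proj₂ column₀) (proj₂ column₁) (proj₂ column₂)
        (proj₁ (proj₂ (exhaustive⇒basis P₀ P₁ P₂ exhaustive)))

      divisor : ∀ D → D ∣ N → D ∣ h → D ∣ c → D ∣ d → D ≡ 1
      divisor D D∣N D∣h D∣c D∣d = ∣1⇒≡1 (common-divisor D D∣N (∀-permuted π D∣a) (∀-permuted π D∣b))
        where
        D∣h* : ∀ {x y} → x ≡ h * y → D ∣ x
        D∣h* {y = y} refl = ∣m⇒∣m*n y D∣h

        D∣a : ∀ i → D ∣ a (π ⟨$⟩ˡ i)
        D∣a 0F = D∣h* (proj₁ column₀)
        D∣a 1F = D∣h* (proj₁ column₁)
        D∣a 2F = D∣h* (proj₁ column₂)
        D∣a 3F = D∣c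
        D∣a 4F = ∣m+n∣m⇒∣n (∣-trans D∣N N∣c+c′) D∣c

        D∣b : ∀ i → D ∣ b (π ⟨$⟩ˡ i)
        D∣b 0F = D∣h* (proj₂ column₀)
        D∣b 1F = D∣h* (proj₂ column₁)
        D∣b 2F = D∣h* (proj₂ column₂)
        D∣b 3F = D∣d
        D∣b 4F = ∣m+n∣m⇒∣n (∣-trans D∣N N∣d+d′) D∣d

      even⇒directSum : 2 ∣ c → 2 ∣ d → IsDirectSum C
      even⇒directSum 2∣c 2∣d = isDirectSum π λ w → mk⇔
          (λ w∈ → spanned-cong (λ i → ≈-reflexive (A≡ i)) (λ i → ≈-reflexive (B≡ i))
            (Equivalence.to (∈C⇔-permuted π ∈C⇔spanned w) w∈))
          (λ w∈ → Equivalence.from (∈C⇔-permuted π ∈C⇔spanned w)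
            (spanned-cong (λ i → ≈-reflexive (sym (A≡ i))) (λ i → ≈-reflexive (sym (B≡ i))) w∈))
        where
        h-odd : h % 2 ≡ 1
        h-odd with even-or-odd h
        ... | inj₂ odd = odd
        ... | inj₁ even with () ← divisor 2 2∣N (m%n≡0⇒n∣m h 2 even) 2∣c 2∣d

        2∣c′ : 2 ∣ c′
        2∣c′ = ∣m+n∣m⇒∣n (∣-trans 2∣N N∣c+c′) 2∣c

        2∣d′ : 2 ∣ d′
        2∣d′ = ∣m+n∣m⇒∣n (∣-trans 2∣N N∣d+d′) 2∣d

        α β : Fin 3 → ℤ
        α = lookup (+ X P₀ ∷ + X P₁ ∷ + X P₂ ∷ [])
        β = lookup (+ Y P₀ ∷ + Y P₁ ∷ + Y P₂ ∷ [])

        γ δ : Fin 2 → ℤ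
        γ = lookup (+ quotient 2∣c ∷ + quotient 2∣c′ ∷ [])
        δ = lookup (+ quotient 2∣d ∷ + quotient 2∣d′ ∷ [])

        open SplitColumns N h (h / 2) N≡ (odd⇒≡ h h-odd) α β γ δ

        double-form : ∀ {m} (2∣m : 2 ∣ m) → + m ≡ + 2 ℤ.* + quotient 2∣m
        double-form 2∣m = pos-product 2 (quotient 2∣m) (m∣n⇒n≡m*quotient 2∣m)

        A≡ : ∀ i → + a (π ⟨$⟩ˡ i) ≡ column (+ h) α γ i
        A≡ 0F = pos-product h (X P₀) (proj₁ column₀)
        A≡ 1F = pos-product h (X P₁) (proj₁ column₁)
        A≡ 2F = pos-product h (X P₂) (proj₁ column₂)
        A≡ 3F = double-form 2∣c
        A≡ 4F = double-form 2∣c′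

        B≡ : ∀ i → + b (π ⟨$⟩ˡ i) ≡ column (+ h) β δ i
        B≡ 0F = pos-product h (Y P₀) (proj₂ column₀)
        B≡ 1F = pos-product h (Y P₁) (proj₂ column₁)
        B≡ 2F = pos-product h (Y P₂) (proj₂ column₂)
        B≡ 3F = double-form 2∣d
        B≡ 4F = double-form 2∣d′

      ¬even⇒coprime : ¬ (2 ∣ c × 2 ∣ d) → gcd (gcd c d) N ≡ 1
      ¬even⇒coprime ¬even = divisor D D∣N D∣h D∣c D∣d
        where
        D : ℕ
        D = gcd (gcd c d) N

        D∣N : D ∣ N
        D∣N = gcd[m,n]∣n (gcd c d) N

        D∣c : D ∣ c
        D∣c = ∣-trans (gcd[m,n]∣m (gcd c d) N) (gcd[m,n]∣m c d)

        D∣d : D ∣ d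
        D∣d = ∣-trans (gcd[m,n]∣m (gcd c d) N) (gcd[m,n]∣n c d)

        D∣h : D ∣ h
        D∣h with even-or-odd D
        ... | inj₁ even = contradiction (∣-trans (m%n≡0⇒n∣m D 2 even) D∣c , ∣-trans (m%n≡0⇒n∣m D 2 even) D∣d) ¬even
        ... | inj₂ odd = ∣m+n∣m⇒∣n
          (subst (D ∣_) (trans (cong (h *_) (odd⇒≡ D odd)) (lemma h (D / 2))) (n∣m*n h))
          (∣n⇒∣m*n (D / 2) (subst (D ∣_) N≡ D∣N))
          where
          lemma : ∀ h k → h * (1 + k * 2) ≡ k * (h * 2) + h
          lemma = solve-∀

      thin-code : c % 2 ≡ X P₂ → d % 2 ≡ Y P₂ → ¬ (2 ∣ c × 2 ∣ d) → C ≅ rowSpan (thinMatrix N)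
      thin-code c% d% ¬even = π , λ w → mk⇔
        (λ w∈ → Equivalence.from (thinMatrix-spanned N h N≡ (permute π w))
          (subst (Spanned _ _ _) (sym N≡) (spanned⇒thin columns
            (subst (Spanned _ _ _) N≡ (Equivalence.to (∈C⇔-permuted π ∈C⇔spanned w) w∈)))))
        (λ w∈ → Equivalence.from (∈C⇔-permuted π ∈C⇔spanned w)
          (subst (Spanned _ _ _) (sym N≡) (thin⇒spanned columns
            (subst (Spanned _ _ _) N≡ (Equivalence.to (thinMatrix-spanned N h N≡ (permute π w)) w∈)))))
        where
        basis : (X P₀ + X P₁ + X P₂) % 2 ≡ 0 × (Y P₀ + Y P₁ + Y P₂) % 2 ≡ 0 ×
                (X P₁ * Y P₂ + Y P₁ * X P₂) % 2 ≡ 1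
        basis = exhaustive⇒basis P₀ P₁ P₂ exhaustive

        uv : ∃₂ λ u v → u ℤ.* + c ℤ.+ v ℤ.* + d ≈[ N ] 1ℤ
        uv = bézout-mod c d N (¬even⇒coprime ¬even)

        open ThinForm h (lookup (+ X P₀ ∷ + X P₁ ∷ + X P₂ ∷ [])) (lookup (+ Y P₀ ∷ + Y P₁ ∷ + Y P₂ ∷ []))
          (+ c) (+ d) (proj₁ uv) (proj₁ (proj₂ uv))
          (%⇒≈ (X P₀ + X P₁ + X P₂) 2 (proj₁ basis))
          (%⇒≈ (Y P₀ + Y P₁ + Y P₂) 2 (proj₁ (proj₂ basis)))
          (%⇒≈ c 2 c%) (%⇒≈ d 2 d%)
          (subst (_≈[ 2 ] 1ℤ) (cong₂ ℤ._+_ (ℤ.pos-* (X P₁) (Y P₂)) (ℤ.pos-* (Y P₁) (X P₂)))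
            (%⇒≈ (X P₁ * Y P₂ + Y P₁ * X P₂) 2 (proj₂ (proj₂ basis))))
          (subst (proj₁ uv ℤ.* + c ℤ.+ proj₁ (proj₂ uv) ℤ.* + d ≈[_] 1ℤ) N≡ (proj₂ (proj₂ uv)))

        opposite : ∀ {m m′} → N ∣ m + m′ → + m′ ≈[ h * 2 ] ℤ.- + m
        opposite {m} {m′} N∣ = subst₂ (_≈[ h * 2 ]_) (lemma (+ m) (+ m′)) (ℤ.+-identityˡ _)
          (+-cong-≈ (∣⇒≈0 (subst (_∣ m + m′) N≡ N∣)) (≈-reflexive {x = ℤ.- + m} refl))
          where
          lemma : ∀ x y → x ℤ.+ y ℤ.+ (ℤ.- x) ≡ y
          lemma = ℤ-solve-∀

        columns : Columns (λ i → + a (π ⟨$⟩ˡ i)) (λ i → + b (π ⟨$⟩ˡ i))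
        columns = record
          { A₀ = pos-product h (X P₀) (proj₁ column₀)
          ; A₁ = pos-product h (X P₁) (proj₁ column₁)
          ; A₂ = pos-product h (X P₂) (proj₁ column₂)
          ; A₃ = refl
          ; A₄ = opposite N∣c+c′
          ; B₀ = pos-product h (Y P₀) (proj₂ column₀)
          ; B₁ = pos-product h (Y P₁) (proj₂ column₁)
          ; B₂ = pos-product h (Y P₂) (proj₂ column₂)
          ; B₃ = refl
          ; B₄ = opposite N∣d+d′
          }

    normalised⇒thin : ∀ {π P₀ P₁ P₂} → ¬ IsDirectSum C → Normalised π P₀ P₁ P₂ →
                      C ≅ rowSpan (thinMatrix N)
    normalised⇒thin {π} {P₀} {P₁} {P₂} ¬ds norm@(normalised p₀ p₁ p₂ exhaustive) =
      [ (λ even → contradiction even ¬even) , (λ (Q , c% , d%) → choose c% d% (exhaustive Q)) ]′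
        (parities (a (π ⟨$⟩ˡ 3F)) (b (π ⟨$⟩ˡ 3F)))
      where
      ¬even : ¬ (2 ∣ a (π ⟨$⟩ˡ 3F) × 2 ∣ b (π ⟨$⟩ˡ 3F))
      ¬even (2∣c , 2∣d) = ¬ds (even⇒directSum norm 2∣c 2∣d)

      norm₁ : Normalised (π ∘ₚ transpose 1F 2F) P₀ P₂ P₁
      norm₁ = normalised p₀ p₂ p₁ λ Q → [ inj₁ , [ inj₂ ∘ inj₂ , inj₂ ∘ inj₁ ]′ ]′ (exhaustive Q)

      norm₀ : Normalised (π ∘ₚ transpose 0F 2F) P₂ P₁ P₀
      norm₀ = normalised p₂ p₁ p₀ λ Q → [ inj₂ ∘ inj₂ , [ inj₂ ∘ inj₁ , inj₁ ]′ ]′ (exhaustive Q)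

      choose : ∀ {Q} → a (π ⟨$⟩ˡ 3F) % 2 ≡ X Q → b (π ⟨$⟩ˡ 3F) % 2 ≡ Y Q →
               P₀ ≡ Q ⊎ P₁ ≡ Q ⊎ P₂ ≡ Q → C ≅ rowSpan (thinMatrix N)
      choose c% d% (inj₁ refl)        = thin-code norm₀ c% d% ¬even
      choose c% d% (inj₂ (inj₁ refl)) = thin-code norm₁ c% d% ¬even
      choose c% d% (inj₂ (inj₂ refl)) = thin-code norm c% d% ¬even

  Thin⇒≅thin : ¬ Degenerate C → ¬ IsDirectSum C → Thin C → 2 ∣ N × C ≅ rowSpan (thinMatrix N)
  Thin⇒≅thin ¬deg ¬ds thin = conclude (three-columns ¬deg thin)
    where
    conclude : (∃[ π ] CoveringBelow a b 3 π × Kills 3 2 π) → 2 ∣ N × C ≅ rowSpan (thinMatrix N)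
    conclude (π , cov , kills) =
      let h , N≡ = even-order {π} ¬deg kills
          _ , _ , _ , norm = normalise h N≡ {π} ¬deg cov kills
      in divides h N≡ , normalised⇒thin h N≡ ¬ds norm

proposition3p4 : (N : ℕ) .{{_ : NonZero N}} → N ≥ 9 →
    (C : Code N 5) → IsLinear C → Admissible C →
    (∃[ G ] IsGeneratedBy {m = 2} C G) →
    ¬ Degenerate C → ¬ IsDirectSum C →
    Thin C ⇔ (2 ∣ N × C ≅ rowSpan (thinMatrix N))
proposition3p4 N N≥9 C _ (extended , isGCD) (r ∷ r′ ∷ [] , generated) ¬deg ¬ds = mk⇔
  (GeneratedCode.Thin⇒≅thin N N≥9 C extended isGCD r r′ generated ¬deg ¬ds)
  (λ (2∣N , C≅) → ≅thin⇒Thin 2∣N C≅)
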